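{- Let $n\ge 1$ be an integer, let $U\subseteq\mathbb{R}^2$ be open, and let $F:U\to\mathbb{R}$, $(x,y)\mapsto F(x,y)$, be $n$ times continuously differentiable. Suppose the equation $F(x,y)=0$ defines $y$ as an implicit function of $x$, i.e. $y=y(x)$ is a differentiable real-valued function on an open interval $J\subseteq\mathbb{R}$ with $(x,y(x))\in U$ and $F(x,y(x))=0$ for all $x\in J$, and suppose $F_y(x,y(x))\ne 0$ for all $x\in J$. Then for every $x\in J$, \[ \frac{d^ny}{dx^n}=\sum_{k=1}^{2n-1}(-1)^k F_y^{ -k}\,\boldsymbol{I}_{n,k}, \] where the right-hand side is evaluated at the point $(x,y(x))$.
   Context: Subscripts on $F$ denote partial derivatives: $F_x=\partial F/\partial x$, $F_y=\partial F/\partial y$, etc.; $F_y^{ -k}$ means $(F_y)^{ -k}$. Definition of $\boldsymbol{I}_{n,k}$: for integers $n\ge1$, $k\ge1$, consider the set $\{1,2,\dots,n+k-1\}$. The elements $1,\dots,n$ are called small and the elements $n+1,\dots,n+k-1$ are called large. Let $\Sigma_{n,k}$ be the set of all set partitions of $\{1,2,\dots,n+k-1\}$ into exactly $k$ (nonempty) blocks such that no large element forms a singleton block. For a block $B$ let $s(B)$ be the number of small elements in $B$ and $\ell(B)$ the number of large elements in $B$. Then \[ \boldsymbol{I}_{n,k}=\sum_{\pi\in\Sigma_{n,k}}\ \prod_{B\in\pi}\frac{\partial^{\,s(B)+\ell(B)}F}{\partial x^{s(B)}\,\partial y^{\ell(B)}} \] (small elements correspond to $x$-derivatives and large elements to $y$-derivatives).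 An empty sum is $0$. -}

module Defs where

open import Algebra.Bundles using (CommutativeRing)
open import Data.Bool.Properties using () renaming (_≟_ to _≟ᵇ_)
open import Data.Fin.Properties using (all?)
open import Data.Fin.Subset
  using (Subset; inside; outside; _∈_; _∉_; _∩_; ∁; ⁅_⁆; ∣_∣; Nonempty; Empty)
open import Data.Fin.Subset.Properties using (_∈?_; nonempty?)
open import Data.List.Base
  using (List; []; _∷_; _++_; map; foldr; filter; length; replicate)
open import Data.List.Relation.Unary.All as All using (All)
open import Data.List.Relation.Unary.AllPairs using (AllPairs; allPairs?)
open import Data.List.Relation.Unary.Any as Any using (Any)
open import Data.Nat.Base as ℕ using (ℕ; zero; suc; pred)
import Data.Nat.Properties as ℕ
open import Data.Product.Base using (∃; _×_; _,_)
import Data.Vec.Base as Vec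
open import Data.Vec.Properties using (≡-dec)
open import Level using (0ℓ)
open import Relation.Binary.Core using (Rel)
open import Relation.Binary.Definitions using (tri<; tri≈; tri>)
import Relation.Binary.Construct.StrictToNonStrict as StrictToNonStrict
open import Relation.Binary.PropositionalEquality using (_≡_; _≢_)
open import Relation.Binary.Structures using (IsStrictTotalOrder)
open import Relation.Nullary using (¬_; Dec; ¬?)
open import Relation.Nullary.Decidable using (_×-dec_; _→-dec_)
open import Relation.Unary using (Pred; Satisfiable)

-- The real numbers are taken axiomatically, as a Dedekind-complete ordered
-- field (unique up to isomorphism).  Equality is the setoid equality _≈_.
-- Inversion is total, with an unspecified value at 0.
record CompleteOrderedField : Set₁ where
  field
    commutativeRing : CommutativeRing 0ℓ 0ℓ

  open CommutativeRing commutativeRing public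

  infix 4 _<_
  infix 9 _⁻¹

  field
    0≉1                : 0# ≉ 1#
    _⁻¹                : Carrier → Carrier
    ⁻¹-cong            : ∀ {x y} → x ≈ y → x ⁻¹ ≈ y ⁻¹
    ⁻¹-inverseʳ        : ∀ {x} → x ≉ 0# → x * x ⁻¹ ≈ 1#
    _<_                : Rel Carrier 0ℓ
    isStrictTotalOrder : IsStrictTotalOrder _≈_ _<_
    +-monoˡ-<          : ∀ {x y} z → x < y → x + z < y + z
    *-pos              : ∀ {x y} → 0# < x → 0# < y → 0# < x * y

  open StrictToNonStrict _≈_ _<_ public using (_≤_)

  UpperBound : Pred Carrier 0ℓ → Pred Carrier 0ℓ
  UpperBound P u = ∀ {x} → P x → x ≤ u

  field
    supremum : (P : Pred Carrier 0ℓ) → Satisfiable P → Satisfiable (UpperBound P) →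
               ∃ λ s → UpperBound P s × (∀ {u} → UpperBound P u → s ≤ u)

  open IsStrictTotalOrder isStrictTotalOrder public using (compare)

  abs : Carrier → Carrier
  abs x with compare x 0#
  ... | tri< _ _ _ = - x
  ... | tri≈ _ _ _ = x
  ... | tri> _ _ _ = x

module _ {m : ℕ} where

  Disjoint : Rel (Subset m) 0ℓ
  Disjoint B C = Empty (B ∩ C)

  IsSetPartition : Pred (List (Subset m)) 0ℓ
  IsSetPartition π = All Nonempty π × AllPairs Disjoint π × (∀ i → Any (i ∈_) π)

  -- For a set S ("small" elements) whose complement consists of the "large" ones.
  NoLargeSingleton : Subset m → Pred (List (Subset m)) 0ℓ
  NoLargeSingleton S π = ∀ i → i ∉ S → All (_≢ ⁅ i ⁆) π

  isSetPartition? : ∀ π → Dec (IsSetPartition π)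
  isSetPartition? π =
    All.all? nonempty? π ×-dec
    allPairs? (λ B C → ¬? (nonempty? (B ∩ C))) π ×-dec
    all? (λ i → Any.any? (i ∈?_) π)

  noLargeSingleton? : ∀ S π → Dec (NoLargeSingleton S π)
  noLargeSingleton? S π =
    all? λ i → ¬? (i ∈? S) →-dec All.all? (λ B → ¬? (≡-dec _≟ᵇ_ B ⁅ i ⁆)) π

subsets : ∀ m → List (Subset m)
subsets zero    = Vec.[] ∷ []
subsets (suc m) = map (outside Vec.∷_) (subsets m) ++ map (inside Vec.∷_) (subsets m)

sublists : ∀ {A : Set} → List A → List (List A)
sublists []       = [] ∷ []
sublists (x ∷ xs) = sublists xs ++ map (x ∷_) (sublists xs)

-- Since subsets m lists every subset of Fin m exactly once, its sublists
-- represent every set of subsets of Fin m exactly once.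
families : ∀ m → List (List (Subset m))
families m = sublists (subsets m)

-- The ground set {1, …, n + k - 1} is Fin (n + pred k), where k ≥ 1 is intended.
small : ∀ n k → Subset (n ℕ.+ pred k)
small n k = Vec.replicate n inside Vec.++ Vec.replicate (pred k) outside

InΣ : ∀ n k → Pred (List (Subset (n ℕ.+ pred k))) 0ℓ
InΣ n k π = IsSetPartition π × length π ≡ k × NoLargeSingleton (small n k) π

inΣ? : ∀ n k π → Dec (InΣ n k π)
inΣ? n k π = isSetPartition? π ×-dec (length π ℕ.≟ k) ×-dec noLargeSingleton? (small n k) π

Σ[_,_] : ∀ n k → List (List (Subset (n ℕ.+ pred k)))
Σ[ n , k ] = filter (inΣ? n k) (families (n ℕ.+ pred k))

#small #large : ∀ n k → Subset (n ℕ.+ pred k) → ℕ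
#small n k B = ∣ B ∩ small n k ∣
#large n k B = ∣ B ∩ ∁ (small n k) ∣

data Variable : Set where
  𝕩 𝕪 : Variable

module Calculus (R : CompleteOrderedField) where

  open CompleteOrderedField R

  ℝ : Set
  ℝ = Carrier

  ℝ² : Set
  ℝ² = ℝ × ℝ

  Near : ℝ → ℝ² → ℝ² → Set
  Near δ (a , b) (a′ , b′) = abs (a′ - a) < δ × abs (b′ - b) < δ

  Open : Pred ℝ 0ℓ → Set
  Open S = ∀ {a} → S a → ∃ λ ε → 0# < ε × (∀ b → abs (b - a) < ε → S b)

  Open² : Pred ℝ² 0ℓ → Set
  Open² U = ∀ {p} → U p → ∃ λ ε → 0# < ε × (∀ q → Near ε p q → U q)

  IsOpenInterval : Pred ℝ 0ℓ → Set
  IsOpenInterval J = Open J × (∀ {a b c} → J a → J c → a < b → b < c → J b)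

  -- A function with domain S is represented by a function on all of ℝ (or ℝ²)
  -- whose values outside S are irrelevant.

  RespectsEqualityOn : Pred ℝ 0ℓ → (ℝ → ℝ) → Set
  RespectsEqualityOn S f = ∀ {a b} → S a → S b → a ≈ b → f a ≈ f b

  ContinuousOn : Pred ℝ² 0ℓ → (ℝ² → ℝ) → Set
  ContinuousOn U f = ∀ {p} → U p → ∀ ε → 0# < ε →
    ∃ λ δ → 0# < δ × (∀ q → U q → Near δ p q → abs (f q - f p) < ε)

  HasDerivative : Pred ℝ 0ℓ → (ℝ → ℝ) → ℝ → ℝ → Set
  HasDerivative S f a d = ∀ ε → 0# < ε →
    ∃ λ δ → 0# < δ ×
      (∀ b → S b → b ≉ a → abs (b - a) < δ →
        abs ((f b - f a) * (b - a) ⁻¹ - d) < ε)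

  DifferentiableOn : Pred ℝ 0ℓ → (ℝ → ℝ) → Set
  DifferentiableOn S f = ∀ {a} → S a → ∃ λ d → HasDerivative S f a d

  IsNthDerivative : Pred ℝ 0ℓ → ℕ → (ℝ → ℝ) → (ℝ → ℝ) → Set
  IsNthDerivative S zero    f g = ∀ {a} → S a → g a ≈ f a
  IsNthDerivative S (suc n) f g =
    ∃ λ h → IsNthDerivative S n f h × (∀ {a} → S a → HasDerivative S h a (g a))

  HasPartial : Pred ℝ² 0ℓ → Variable → (ℝ² → ℝ) → ℝ² → ℝ → Set
  HasPartial U 𝕩 f (a , b) d = HasDerivative (λ t → U (t , b)) (λ t → f (t , b)) a d
  HasPartial U 𝕪 f (a , b) d = HasDerivative (λ t → U (a , t)) (λ t → f (a , t)) b d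

  -- All iterated partial derivatives of order at most n, taken in any order of
  -- the variables, exist and are continuous.  The word v₁ ∷ v₂ ∷ … ∷ []
  -- stands for ∂/∂v₁ (∂/∂v₂ …), and ∂ is meaningful only on words of length ≤ n.
  record ContDiff (n : ℕ) (U : Pred ℝ² 0ℓ) (F : ℝ² → ℝ) : Set where
    field
      ∂            : List Variable → ℝ² → ℝ
      ∂-[]         : ∀ {p} → U p → ∂ [] p ≈ F p
      ∂-∷          : ∀ v w → length w ℕ.< n → ∀ {p} → U p → HasPartial U v (∂ w) p (∂ (v ∷ w) p)
      ∂-continuous : ∀ w → length w ℕ.≤ n → ContinuousOn U (∂ w)

    -- ∂ˢ⁺ˡF / ∂xˢ∂yˡ; meaningful for s + l ≤ n.
    mixed : ℕ → ℕ → ℝ² → ℝ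
    mixed s l = ∂ (replicate s 𝕩 ++ replicate l 𝕪)

    Fy : ℝ² → ℝ
    Fy = mixed 0 1

  sum product : List ℝ → ℝ
  sum     = foldr _+_ 0#
  product = foldr _*_ 1#

  module _ {N U F} (C : ContDiff N U F) where

    open ContDiff C

    I : ℕ → ℕ → ℝ² → ℝ
    I n k p = sum (map term Σ[ n , k ])
      where
      term : List (Subset (n ℕ.+ pred k)) → ℝ
      term π = product (map (λ B → mixed (#small n k B) (#large n k B) p) π)

{-# OPTIONS --safe #-}

-- Along the curve, d/dx = ∂/∂x + u Fx ∂/∂y with u = - 1/Fy, hence
-- u′ = u² (Fxy + u Fx Fyy).  Classify the set partitions counted by I (m + 1, k)
-- by the block of a new small element: it joins a block of a partition counted
-- by I (m, k) (giving ∂/∂x), or it joins a large singleton (giving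
-- (k - 1) Fxy I (m, k - 1)), or it is a singleton.  In the last case remove in
-- turn a large element: either it was in a block that remains admissible
-- (giving Fx ∂/∂y of I (m, k - 1)), or it formed a block with one other large
-- element (giving (k - 2) Fx Fyy I (m, k - 2)).  These are exactly the terms of
-- the derivative of Σ uᵏ I (m, k).  The chain rule and the symmetry of the mixed
-- partial derivatives come from a mean value inequality, proved by induction
-- along an interval.
module Submission where

open import Defs
open import Axiom.ExcludedMiddle using (ExcludedMiddle)
open import Data.List.Base using (map; upTo)
open import Data.Nat.Base as ℕ using (ℕ; suc)
open import Data.Product.Base using (_,_)
open import Level using (0ℓ)
open import Relation.Unary using (Pred)
import Algebra.Properties.Semiring.Exp as Exp

open import Algebra.Bundles using (CommutativeRing)
import Algebra.Properties.Ring
import Algebra.Properties.Semiring.Mult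
import Algebra.Properties.Semiring.Mult.TCOptimised
import Algebra.Solver.Ring
import Algebra.Solver.Ring.AlmostCommutativeRing as ACR
open import Data.Empty using (⊥-elim)
open import Data.Fin.Base using (zero; suc)
open import Data.Fin.Subset
  using (Subset; Side; inside; outside; _∈_; _∉_; _∩_; ∁; ⁅_⁆; ∣_∣; Nonempty; Empty)
  renaming (⊥ to ∅)
open import Data.Fin.Subset.Properties
  using (nonempty?; drop-there; ∉⊥; ∣⊥∣≡0; ∩-zeroˡ; ∩-comm; x∈p∩q⁺; p∩q⊆p)
open import Data.Integer.Base as ℤ using (ℤ; +_; -[1+_]; +[1+_]; _⊖_)
import Data.Integer.Properties as ℤ
open import Data.List.Base
  using (List; []; _∷_; _++_; length; replicate; foldr; filter; applyUpTo)
open import Data.List.Membership.Propositional using () renaming (_∈_ to _∈ₗ_)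
open import Data.List.Properties
  using (map-∘; map-upTo; ++-identityʳ; length-map; length-++; length-replicate)
open import Data.List.Relation.Binary.Permutation.Propositional as Perm using (_↭_; ↭⇒↭ₛ)
open import Data.List.Relation.Binary.Permutation.Propositional.Properties
  using (All-resp-↭; Any-resp-↭; ↭-length; ++-comm) renaming (map⁺ to ↭-map⁺)
import Data.List.Relation.Binary.Permutation.Setoid.Properties as SetoidPerm
open import Data.List.Relation.Unary.All as All using (All; []; _∷_)
import Data.List.Relation.Unary.All.Properties as All
open import Data.List.Relation.Unary.AllPairs as AllPairs using (AllPairs; []; _∷_)
import Data.List.Relation.Unary.AllPairs.Properties as AllPairs
open import Data.List.Relation.Unary.Any as Any using (Any; here; there)
import Data.List.Relation.Unary.Any.Properties as Any
open import Data.Maybe.Base as Maybe using (Maybe)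
open import Data.Nat.Base using (zero; pred)
open import Data.Nat.ListAction using () renaming (sum to ∑ℕ)
open import Data.Nat.ListAction.Properties using (sum-↭)
import Data.Nat.Properties as ℕ
open import Data.Nat.Solver using (module +-*-Solver)
open import Data.Product.Base using (∃; _×_; proj₁; proj₂)
open import Data.Product.Properties using () renaming (≡-dec to ×-≡-dec)
import Data.Sign.Base as Sign
open import Data.Sum.Base using (_⊎_; inj₁; inj₂)
import Data.Vec.Base as Vec
open import Relation.Binary.Bundles using (StrictPartialOrder)
import Relation.Binary.Construct.StrictToNonStrict as StrictToNonStrict
open import Relation.Binary.Core using (Rel)
open import Relation.Binary.Definitions using (Transitive; Tri; tri<; tri≈; tri>)
open import Relation.Binary.PropositionalEquality as ≡ using (_≡_; _≢_)
import Relation.Binary.Reasoning.Setoid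
import Relation.Binary.Reasoning.StrictPartialOrder
open import Relation.Binary.Structures using (IsStrictTotalOrder)
open import Relation.Nullary using (¬_; ¬?; Dec; yes; no)
open import Relation.Nullary.Decidable using (dec⇒maybe)

-- The ground set of I (m, k) changes with m and k, so relating these sums by explicit bijections
-- between families of subsets would be laborious. But a summand depends only on the types (s, l) of
-- its blocks. Families are therefore reduced once to lists of types, and `insert`, adjoint to
-- adding one element, acts on functionals of such lists; reclassifying partitions becomes algebra
-- with operators. The ban on large singletons turns into the weight 0 of the type (0, 1), so all
-- sums run over all set partitions. The price: joining a new element to a large singleton gives a
-- term that the derivative of the weight does not see, and `mark` collects it separately.
-- Throughout, j = k - 1 is the number of large elements. Two counts tie the formula to its
-- hypotheses. If j + 1 nonempty blocks share m + j elements, each has size at most m, so only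
-- derivatives of order at most m occur. Without large singletons j + 1 is at most 2 m - 1, so the
-- sum may stop there and the boundary terms of the recurrence vanish. Excluded middle enters in the
-- induction along an interval, to find a point just below a supremum.

module IntegerSolver {c ℓ} (R : CommutativeRing c ℓ) where

  open CommutativeRing R
  open import Algebra.Properties.Semiring.Mult.TCOptimised semiring renaming (_×_ to _·_)
  open import Algebra.Properties.Ring ring
  open import Relation.Binary.Reasoning.Setoid setoid

  private

    -- Coefficients are taken in ℤ because equality there is decidable; cancellations are then
    -- recognised in an arbitrary commutative ring.
    ⟦_⟧ : ℤ → Carrier
    ⟦ + n ⟧      = n · 1#
    ⟦ -[1+ n ] ⟧ = - (suc n · 1#)

    ⊖-homo : ∀ m n → ⟦ m ⊖ n ⟧ ≈ m · 1# - n · 1#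
    ⊖-homo m       zero    = sym (trans (+-congˡ -0#≈0#) (+-identityʳ _))
    ⊖-homo zero    (suc n) = sym (+-identityˡ _)
    ⊖-homo (suc m) (suc n) = begin
      ⟦ suc m ⊖ suc n ⟧                     ≡⟨ ≡.cong ⟦_⟧ (ℤ.[1+m]⊖[1+n]≡m⊖n m n) ⟩
      ⟦ m ⊖ n ⟧                             ≈⟨ ⊖-homo m n ⟩
      m · 1# - n · 1#                       ≈⟨ +-congʳ (+-identityˡ _) ⟨
      (0# + m · 1#) - n · 1#                ≈⟨ +-congʳ (+-congʳ (-‿inverseʳ 1#)) ⟨
      ((1# - 1#) + m · 1#) - n · 1#         ≈⟨ +-congʳ (+-assoc _ _ _) ⟩
      (1# + (- 1# + m · 1#)) - n · 1#       ≈⟨ +-congʳ (+-congˡ (+-comm _ _)) ⟩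
      (1# + (m · 1# - 1#)) - n · 1#         ≈⟨ +-congʳ (+-assoc _ _ _) ⟨
      ((1# + m · 1#) - 1#) - n · 1#         ≈⟨ +-assoc _ _ _ ⟩
      (1# + m · 1#) + (- 1# - n · 1#)       ≈⟨ +-cong (1+× m 1#) (trans (-‿cong (1+× n 1#)) (sym (-‿+-comm _ _))) ⟨
      suc m · 1# - suc n · 1#               ∎

    +-homo : ∀ i j → ⟦ i ℤ.+ j ⟧ ≈ ⟦ i ⟧ + ⟦ j ⟧
    +-homo (+ m)      (+ n)      = ×-homo-+ 1# m n
    +-homo (+ m)      -[1+ n ]   = ⊖-homo m (suc n)
    +-homo -[1+ m ]   (+ n)      = trans (⊖-homo n (suc m)) (+-comm _ _)
    +-homo -[1+ m ]   -[1+ n ]   = begin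
      - (suc (suc (m ℕ.+ n)) · 1#)   ≡⟨ ≡.cong (λ k → - (k · 1#)) (≡.cong suc (≡.sym (ℕ.+-suc m n))) ⟩
      - ((suc m ℕ.+ suc n) · 1#)     ≈⟨ -‿cong (×-homo-+ 1# (suc m) (suc n)) ⟩
      - (suc m · 1# + suc n · 1#)    ≈⟨ -‿+-comm _ _ ⟨
      - (suc m · 1#) - (suc n · 1#)  ∎

    -◃-homo : ∀ n → ⟦ Sign.- ℤ.◃ n ⟧ ≈ - (n · 1#)
    -◃-homo zero    = sym -0#≈0#
    -◃-homo (suc n) = refl

    *-homo : ∀ i j → ⟦ i ℤ.* j ⟧ ≈ ⟦ i ⟧ * ⟦ j ⟧
    *-homo (+ m)    (+ n)    = trans (reflexive (≡.cong ⟦_⟧ (ℤ.+◃n≡+n (m ℕ.* n)))) (×1-homo-* m n)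
    *-homo (+ m)    -[1+ n ] = begin
      ⟦ Sign.- ℤ.◃ (m ℕ.* suc n) ⟧  ≈⟨ -◃-homo (m ℕ.* suc n) ⟩
      - ((m ℕ.* suc n) · 1#)        ≈⟨ -‿cong (×1-homo-* m (suc n)) ⟩
      - ((m · 1#) * (suc n · 1#))   ≈⟨ -‿distribʳ-* _ _ ⟩
      (m · 1#) * - (suc n · 1#)     ∎
    *-homo -[1+ m ] (+ n)    = begin
      ⟦ Sign.- ℤ.◃ (suc m ℕ.* n) ⟧  ≈⟨ -◃-homo (suc m ℕ.* n) ⟩
      - ((suc m ℕ.* n) · 1#)        ≈⟨ -‿cong (×1-homo-* (suc m) n) ⟩
      - ((suc m · 1#) * (n · 1#))   ≈⟨ -‿distribˡ-* _ _ ⟩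
      - (suc m · 1#) * (n · 1#)     ∎
    *-homo -[1+ m ] -[1+ n ] = begin
      (suc m ℕ.* suc n) · 1#             ≈⟨ ×1-homo-* (suc m) (suc n) ⟩
      (suc m · 1#) * (suc n · 1#)        ≈⟨ -‿involutive _ ⟨
      - - ((suc m · 1#) * (suc n · 1#))  ≈⟨ -‿cong (-‿distribˡ-* _ _) ⟩
      - (- (suc m · 1#) * (suc n · 1#))  ≈⟨ -‿distribʳ-* _ _ ⟩
      - (suc m · 1#) * - (suc n · 1#)    ∎

    -‿homo : ∀ i → ⟦ ℤ.- i ⟧ ≈ - ⟦ i ⟧
    -‿homo (+ zero)  = sym -0#≈0#
    -‿homo (+[1+ n ]) = refl
    -‿homo -[1+ n ]  = sym (-‿involutive _)

    homomorphism : ℤ.+-*-rawRing ACR.-Raw-AlmostCommutative⟶ ACR.fromCommutativeRing R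
    homomorphism = record
      { ⟦_⟧ = ⟦_⟧ ; +-homo = +-homo ; *-homo = *-homo ; -‿homo = -‿homo
      ; 0-homo = refl ; 1-homo = refl }

    _≟_ : ∀ i j → Maybe (⟦ i ⟧ ≈ ⟦ j ⟧)
    i ≟ j = Maybe.map (λ eq → reflexive (≡.cong ⟦_⟧ eq)) (dec⇒maybe (i ℤ.≟ j))

  open Algebra.Solver.Ring ℤ.+-*-rawRing (ACR.fromCommutativeRing R) homomorphism _≟_ public
    using (solve; _:=_; _:+_; _:*_; _:-_; :-_; con)

-- Ordered field arithmetic

module OrderedField (R : CompleteOrderedField) where

  open CompleteOrderedField R
  open IntegerSolver commutativeRing
  open import Algebra.Properties.Ring ring public
    using (-‿involutive; -0#≈0#; x≈y⇒x∙y⁻¹≈ε; x∙y⁻¹≈ε⇒x≈y; -‿distribˡ-*; -‿distribʳ-*)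
  open IsStrictTotalOrder isStrictTotalOrder public
    using (isStrictPartialOrder; <-resp-≈; <-respʳ-≈; <-respˡ-≈)
    renaming (trans to <-trans; irrefl to <-irrefl; asym to <-asym; _≟_ to _≈?_)

  strictPartialOrder : StrictPartialOrder _ _ _
  strictPartialOrder = record { isStrictPartialOrder = isStrictPartialOrder }

  module ≤-Reasoning = Relation.Binary.Reasoning.StrictPartialOrder strictPartialOrder
  module ≤ = StrictToNonStrict _≈_ _<_

  <⇒≤ : ∀ {x y} → x < y → x ≤ y
  <⇒≤ = inj₁

  ≈⇒≤ : ∀ {x y} → x ≈ y → x ≤ y
  ≈⇒≤ = inj₂

  ≤-refl : ∀ {x} → x ≤ x
  ≤-refl = inj₂ refl

  ≤-trans : ∀ {x y z} → x ≤ y → y ≤ z → x ≤ z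
  ≤-trans = ≤.trans isEquivalence <-resp-≈ <-trans

  <-≤-trans : ∀ {x y z} → x < y → y ≤ z → x < z
  <-≤-trans = ≤.<-≤-trans <-trans <-respʳ-≈

  ≤-<-trans : ∀ {x y z} → x ≤ y → y < z → x < z
  ≤-<-trans = ≤.≤-<-trans sym <-trans <-respˡ-≈

  ≤-respʳ-≈ : ∀ {x y z} → y ≈ z → x ≤ y → x ≤ z
  ≤-respʳ-≈ eq p = ≤-trans p (inj₂ eq)

  ≤-antisym : ∀ {x y} → x ≤ y → y ≤ x → x ≈ y
  ≤-antisym = ≤.antisym isEquivalence <-trans <-irrefl

  <⇒≉ : ∀ {x y} → x < y → x ≉ y
  <⇒≉ p eq = <-irrefl eq p

  <⇒≱ : ∀ {x y} → x < y → ¬ (y ≤ x)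
  <⇒≱ p q = <-irrefl refl (<-≤-trans p q)

  ≮⇒≥ : ∀ {x y} → ¬ (x < y) → y ≤ x
  ≮⇒≥ {x} {y} p with compare x y
  ... | tri< q _ _ = ⊥-elim (p q)
  ... | tri≈ _ q _ = inj₂ (sym q)
  ... | tri> _ _ q = inj₁ q

  x<y⇒0<y-x : ∀ {x y} → x < y → 0# < y - x
  x<y⇒0<y-x {x} p = <-respˡ-≈ (-‿inverseʳ x) (+-monoˡ-< (- x) p)

  0<y-x⇒x<y : ∀ {x y} → 0# < y - x → x < y
  0<y-x⇒x<y {x} {y} p =
    <-respˡ-≈ (+-identityˡ x) (<-respʳ-≈ (solve 2 (λ x y → y :- x :+ x := y) refl x y) (+-monoˡ-< x p))

  x≤y⇒0≤y-x : ∀ {x y} → x ≤ y → 0# ≤ y - x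
  x≤y⇒0≤y-x         (inj₁ p) = inj₁ (x<y⇒0<y-x p)
  x≤y⇒0≤y-x {x} {y} (inj₂ p) = inj₂ (sym (x≈y⇒x∙y⁻¹≈ε (sym p)))

  0≤y-x⇒x≤y : ∀ {x y} → 0# ≤ y - x → x ≤ y
  0≤y-x⇒x≤y (inj₁ p) = inj₁ (0<y-x⇒x<y p)
  0≤y-x⇒x≤y (inj₂ p) = inj₂ (sym (x∙y⁻¹≈ε⇒x≈y _ _ (sym p)))

  <-by : ∀ {x y p} → 0# < p → p ≈ y - x → x < y
  <-by p eq = 0<y-x⇒x<y (<-respʳ-≈ eq p)

  ≤-by : ∀ {x y p} → 0# ≤ p → p ≈ y - x → x ≤ y
  ≤-by p eq = 0≤y-x⇒x≤y (≤-respʳ-≈ eq p)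

  +-pos : ∀ {x y} → 0# < x → 0# < y → 0# < x + y
  +-pos {x} {y} p q = <-trans q (<-respˡ-≈ (+-identityˡ y) (+-monoˡ-< y p))

  +-pos-nonNeg : ∀ {x y} → 0# < x → 0# ≤ y → 0# < x + y
  +-pos-nonNeg         p (inj₁ q) = +-pos p q
  +-pos-nonNeg {x} {y} p (inj₂ q) = <-respʳ-≈ (trans (sym (+-identityʳ x)) (+-congˡ q)) p

  +-nonNeg : ∀ {x y} → 0# ≤ x → 0# ≤ y → 0# ≤ x + y
  +-nonNeg (inj₁ p) q = inj₁ (+-pos-nonNeg p q)
  +-nonNeg {x} {y} (inj₂ p) q = ≤-respʳ-≈ (trans (sym (+-identityˡ y)) (+-congʳ p)) q

  *-nonNeg : ∀ {x y} → 0# ≤ x → 0# ≤ y → 0# ≤ x * y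
  *-nonNeg (inj₁ p) (inj₁ q) = inj₁ (*-pos p q)
  *-nonNeg {x} {y} (inj₂ p) _ = inj₂ (trans (sym (zeroˡ y)) (*-congʳ p))
  *-nonNeg {x} {y} (inj₁ _) (inj₂ q) = inj₂ (trans (sym (zeroʳ x)) (*-congˡ q))

  +-mono-< : ∀ {a b c d} → a < b → c < d → a + c < b + d
  +-mono-< {a} {b} {c} {d} p q = <-by (+-pos (x<y⇒0<y-x p) (x<y⇒0<y-x q))
    (solve 4 (λ a b c d → (b :- a) :+ (d :- c) := (b :+ d) :- (a :+ c)) refl a b c d)

  +-mono-≤ : ∀ {a b c d} → a ≤ b → c ≤ d → a + c ≤ b + d
  +-mono-≤ {a} {b} {c} {d} p q = ≤-by (+-nonNeg (x≤y⇒0≤y-x p) (x≤y⇒0≤y-x q))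
    (solve 4 (λ a b c d → (b :- a) :+ (d :- c) := (b :+ d) :- (a :+ c)) refl a b c d)

  +-mono-≤-< : ∀ {a b c d} → a ≤ b → c < d → a + c < b + d
  +-mono-≤-< {a} {b} {c} {d} p q = <-by (+-pos-nonNeg (x<y⇒0<y-x q) (x≤y⇒0≤y-x p))
    (solve 4 (λ a b c d → (d :- c) :+ (b :- a) := (b :+ d) :- (a :+ c)) refl a b c d)

  *-monoˡ-≤ : ∀ {a b c} → 0# ≤ c → a ≤ b → a * c ≤ b * c
  *-monoˡ-≤ {a} {b} {c} r p = ≤-by (*-nonNeg (x≤y⇒0≤y-x p) r)
    (solve 3 (λ a b c → (b :- a) :* c := b :* c :- a :* c) refl a b c)

  *-monoʳ-≤ : ∀ {a b c} → 0# ≤ c → a ≤ b → c * a ≤ c * b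
  *-monoʳ-≤ {a} {b} {c} r p = ≤-by (*-nonNeg r (x≤y⇒0≤y-x p))
    (solve 3 (λ a b c → c :* (b :- a) := c :* b :- c :* a) refl a b c)

  *-monoˡ-< : ∀ {a b c} → 0# < c → a < b → a * c < b * c
  *-monoˡ-< {a} {b} {c} r p = <-by (*-pos (x<y⇒0<y-x p) r)
    (solve 3 (λ a b c → (b :- a) :* c := b :* c :- a :* c) refl a b c)

  *-cancelʳ-≤ : ∀ {a b c} → 0# < c → a * c ≤ b * c → a ≤ b
  *-cancelʳ-≤ r p = ≮⇒≥ (λ q → <⇒≱ (*-monoˡ-< r q) p)

  neg-mono-≤ : ∀ {a b} → a ≤ b → - b ≤ - a
  neg-mono-≤ {a} {b} p = ≤-by (x≤y⇒0≤y-x p) (solve 2 (λ a b → b :- a := :- a :- :- b) refl a b)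

  x<0⇒0<-x : ∀ {x} → x < 0# → 0# < - x
  x<0⇒0<-x {x} p = <-respʳ-≈ (+-identityˡ (- x)) (x<y⇒0<y-x p)

  0<1 : 0# < 1#
  0<1 with compare 0# 1#
  ... | tri< p _ _ = p
  ... | tri≈ _ p _ = ⊥-elim (0≉1 p)
  ... | tri> _ _ p = <-respʳ-≈ (solve 0 (:- con (+ 1) :* :- con (+ 1) := con (+ 1)) refl)
                       (*-pos (x<0⇒0<-x p) (x<0⇒0<-x p))

  >⇒≉0 : ∀ {x} → 0# < x → x ≉ 0#
  >⇒≉0 p eq = <-irrefl (sym eq) p

  ⁻¹-inverseˡ : ∀ {x} → x ≉ 0# → x ⁻¹ * x ≈ 1#
  ⁻¹-inverseˡ p = trans (*-comm _ _) (⁻¹-inverseʳ p)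

  ⁻¹-pos : ∀ {x} → 0# < x → 0# < x ⁻¹
  ⁻¹-pos {x} p with compare 0# (x ⁻¹)
  ... | tri< q _ _ = q
  ... | tri≈ _ q _ = ⊥-elim (0≉1 (trans (sym (zeroʳ x)) (trans (*-congˡ q) (⁻¹-inverseʳ (>⇒≉0 p)))))
  ... | tri> _ _ q = ⊥-elim (<-asym 0<1 (<-respʳ-≈ (+-identityˡ 0#) (<-by (*-pos p (x<0⇒0<-x q))
    (trans (sym (-‿distribʳ-* _ _)) (trans (-‿cong (⁻¹-inverseʳ (>⇒≉0 p)))
      (solve 0 (:- con (+ 1) := (con (+ 0) :+ con (+ 0)) :- con (+ 1)) refl))))))

  half : Carrier → Carrier
  half x = x * (1# + 1#) ⁻¹

  half-pos : ∀ {x} → 0# < x → 0# < half x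
  half-pos p = *-pos p (⁻¹-pos (+-pos 0<1 0<1))

  half+half : ∀ x → half x + half x ≈ x
  half+half x = begin
    x * h + x * h           ≈⟨ solve 2 (λ x h → x :* h :+ x :* h := x :* ((con (+ 1) :+ con (+ 1)) :* h)) refl x h ⟩
    x * ((1# + 1#) * h)     ≈⟨ *-congˡ (⁻¹-inverseʳ (>⇒≉0 (+-pos 0<1 0<1))) ⟩
    x * 1#                  ≈⟨ *-identityʳ x ⟩
    x                       ∎
    where
    open import Relation.Binary.Reasoning.Setoid setoid
    h = (1# + 1#) ⁻¹

  half-< : ∀ {x} → 0# < x → half x < x
  half-< {x} p = <-by (half-pos p)
    (trans (solve 1 (λ h → h := (h :+ h) :- h) refl (half x)) (+-congʳ (half+half x)))

  min₂ : ∀ {x y} → 0# < x → 0# < y → ∃ λ z → 0# < z × z ≤ x × z ≤ y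
  min₂ {x} {y} p q with compare x y
  ... | tri< r _ _ = x , p , ≤-refl , inj₁ r
  ... | tri≈ _ r _ = x , p , ≤-refl , inj₂ r
  ... | tri> _ _ r = y , q , inj₁ r , ≤-refl

  abs-cases : ∀ x → (0# ≤ x × abs x ≈ x) ⊎ (x ≤ 0# × abs x ≈ - x)
  abs-cases x with compare x 0#
  ... | tri< p _ _ = inj₂ (inj₁ p , refl)
  ... | tri≈ _ p _ = inj₁ (inj₂ (sym p) , refl)
  ... | tri> _ _ p = inj₁ (inj₁ p , refl)

  x≤0⇒0≤-x : ∀ {x} → x ≤ 0# → 0# ≤ - x
  x≤0⇒0≤-x {x} p = ≤-respʳ-≈ (+-identityˡ (- x)) (x≤y⇒0≤y-x p)

  0≤abs : ∀ x → 0# ≤ abs x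
  0≤abs x with abs-cases x
  ... | inj₁ (p , eq) = ≤-respʳ-≈ (sym eq) p
  ... | inj₂ (p , eq) = ≤-respʳ-≈ (sym eq) (x≤0⇒0≤-x p)

  x≤abs : ∀ x → x ≤ abs x
  x≤abs x with abs-cases x
  ... | inj₁ (p , eq) = inj₂ (sym eq)
  ... | inj₂ (p , eq) = ≤-trans p (0≤abs x)

  -x≤abs : ∀ x → - x ≤ abs x
  -x≤abs x with abs-cases x
  ... | inj₂ (p , eq) = inj₂ (sym eq)
  ... | inj₁ (p , eq) = ≤-trans (≤-respʳ-≈ -0#≈0# (neg-mono-≤ p)) (0≤abs x)

  abs≤ : ∀ {x e} → x ≤ e → - x ≤ e → abs x ≤ e
  abs≤ {x} p q with abs-cases x
  ... | inj₁ (_ , eq) = ≤-trans (inj₂ eq) p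
  ... | inj₂ (_ , eq) = ≤-trans (inj₂ eq) q

  -- Congruence is not read off the case split in `abs`; it comes from the bounds of x and - x by
  -- the absolute value of y.
  abs-cong-≤ : ∀ {x y} → x ≈ y → abs x ≤ abs y
  abs-cong-≤ {x} {y} p = abs≤ (≤-trans (inj₂ p) (x≤abs y)) (≤-trans (inj₂ (-‿cong p)) (-x≤abs y))

  abs-cong : ∀ {x y} → x ≈ y → abs x ≈ abs y
  abs-cong p = ≤-antisym (abs-cong-≤ p) (abs-cong-≤ (sym p))

  abs-neg : ∀ x → abs (- x) ≈ abs x
  abs-neg x = ≤-antisym (abs≤ (-x≤abs x) (≤-trans (inj₂ (-‿involutive x)) (x≤abs x)))
                        (abs≤ (≤-trans (inj₂ (sym (-‿involutive x))) (-x≤abs (- x))) (x≤abs (- x)))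

  abs-swap : ∀ x y → abs (x - y) ≈ abs (y - x)
  abs-swap x y = trans (sym (abs-neg (x - y))) (abs-cong (solve 2 (λ x y → :- (x :- y) := y :- x) refl x y))

  abs-+ : ∀ x y → abs (x + y) ≤ abs x + abs y
  abs-+ x y = abs≤ (+-mono-≤ (x≤abs x) (x≤abs y))
    (≤-trans (inj₂ (solve 2 (λ x y → :- (x :+ y) := :- x :+ :- y) refl x y)) (+-mono-≤ (-x≤abs x) (-x≤abs y)))

  abs-nonNeg : ∀ {x} → 0# ≤ x → abs x ≈ x
  abs-nonNeg {x} p = ≤-antisym (abs≤ ≤-refl (≤-trans (≤-respʳ-≈ -0#≈0# (neg-mono-≤ p)) p)) (x≤abs x)

  abs-0 : ∀ {x} → x ≈ 0# → abs x ≈ 0#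
  abs-0 p = trans (abs-cong p) (abs-nonNeg ≤-refl)

  abs-* : ∀ x y → abs (x * y) ≈ abs x * abs y
  abs-* x y with abs-cases x | abs-cases y
  ... | inj₁ (p , eq) | inj₁ (q , eq′) = trans (abs-nonNeg (*-nonNeg p q)) (sym (*-cong eq eq′))
  ... | inj₁ (p , eq) | inj₂ (q , eq′) =
    trans (sym (abs-neg _)) (trans (abs-cong (-‿distribʳ-* _ _))
      (trans (abs-nonNeg (*-nonNeg p (x≤0⇒0≤-x q))) (sym (*-cong eq eq′))))
  ... | inj₂ (p , eq) | inj₁ (q , eq′) =
    trans (sym (abs-neg _)) (trans (abs-cong (-‿distribˡ-* _ _))
      (trans (abs-nonNeg (*-nonNeg (x≤0⇒0≤-x p) q)) (sym (*-cong eq eq′))))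
  ... | inj₂ (p , eq) | inj₂ (q , eq′) =
    trans (abs-cong (solve 2 (λ x y → x :* y := :- x :* :- y) refl x y))
      (trans (abs-nonNeg (*-nonNeg (x≤0⇒0≤-x p) (x≤0⇒0≤-x q))) (sym (*-cong eq eq′)))

  0<abs : ∀ {x} → x ≉ 0# → 0# < abs x
  0<abs {x} p with 0≤abs x
  ... | inj₁ q = q
  ... | inj₂ q = ⊥-elim (p (≤-antisym (≤-trans (x≤abs x) (inj₂ (sym q)))
                   (≤-trans (inj₂ (sym (trans (-‿cong -0#≈0#) -0#≈0#)))
                     (≤-trans (neg-mono-≤ (≤-trans (-x≤abs x) (inj₂ (trans (sym q) (sym -0#≈0#)))))
                       (inj₂ (-‿involutive x))))))

  abs<⇒≈0 : ∀ {x} → (∀ ε → 0# < ε → abs x < ε) → x ≈ 0#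
  abs<⇒≈0 {x} p with x ≈? 0#
  ... | yes q = q
  ... | no  q = ⊥-elim (<-irrefl refl (p (abs x) (0<abs q)))

  abs≤⇒≈0 : ∀ {x} → (∀ ε → 0# < ε → abs x ≤ ε) → x ≈ 0#
  abs≤⇒≈0 p = abs<⇒≈0 λ ε 0<ε → ≤-<-trans (p (half ε) (half-pos 0<ε)) (half-< 0<ε)

  triangle : ∀ x y z → abs (x - z) ≤ abs (x - y) + abs (y - z)
  triangle x y z = ≤-trans (inj₂ (abs-cong (solve 3 (λ x y z → x :- z := (x :- y) :+ (y :- z)) refl x y z)))
                           (abs-+ (x - y) (y - z))

  <-triangle : ∀ {x y z ε} → abs (x - y) < half ε → abs (y - z) < half ε → abs (x - z) < ε
  <-triangle {x} {y} {z} {ε} p q =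
    ≤-<-trans (triangle x y z) (<-respʳ-≈ (half+half ε) (+-mono-< p q))

  x-y≉0 : ∀ {x y} → x ≉ y → x - y ≉ 0#
  x-y≉0 p q = p (x∙y⁻¹≈ε⇒x≈y _ _ q)

  half-abs< : ∀ {x y} → abs (x - y) < half (abs y) → half (abs y) < abs x
  half-abs< {x} {y} near = <-by (x<y⇒0<y-x (begin-strict
      h + h                      ≈⟨ half+half (abs y) ⟩
      abs y                      ≈⟨ abs-cong (solve 2 (λ x y → y := x :+ :- (x :- y)) refl x y) ⟩
      abs (x + - (x - y))        ≤⟨ abs-+ x (- (x - y)) ⟩
      abs x + abs (- (x - y))    ≈⟨ +-congˡ (abs-neg (x - y)) ⟩
      abs x + abs (x - y)        <⟨ +-mono-≤-< ≤-refl near ⟩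
      abs x + h                  ∎))
    (solve 2 (λ h x → x :+ h :- (h :+ h) := x :- h) refl h (abs x))
    where
    open ≤-Reasoning
    h = half (abs y)

  abs-⁻¹-≤ : ∀ {x m} → 0# < m → m ≤ abs x → abs (x ⁻¹) ≤ m ⁻¹
  abs-⁻¹-≤ {x} {m} 0<m m≤x = *-cancelʳ-≤ 0<m (begin
    abs (x ⁻¹) * m        ≤⟨ *-monoʳ-≤ (0≤abs (x ⁻¹)) m≤x ⟩
    abs (x ⁻¹) * abs x    ≈⟨ abs-* _ _ ⟨
    abs (x ⁻¹ * x)        ≈⟨ abs-cong (⁻¹-inverseˡ x≉0) ⟩
    abs 1#                ≈⟨ abs-nonNeg (<⇒≤ 0<1) ⟩
    1#                    ≈⟨ ⁻¹-inverseˡ (>⇒≉0 0<m) ⟨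
    m ⁻¹ * m              ∎)
    where
    open ≤-Reasoning
    x≉0 : x ≉ 0#
    x≉0 eq = <⇒≱ 0<m (≤-trans m≤x (≈⇒≤ (abs-0 eq)))

-- Limits and derivatives

module Limits (R : CompleteOrderedField) (S : Pred (Calculus.ℝ R) 0ℓ) (a : Calculus.ℝ R) where

  open CompleteOrderedField R
  open Calculus R
  open IntegerSolver commutativeRing
  open OrderedField R

  Eventually : Pred ℝ 0ℓ → Set
  Eventually P = ∃ λ δ → 0# < δ × (∀ b → S b → b ≉ a → abs (b - a) < δ → P b)

  always : ∀ {P : Pred ℝ 0ℓ} → (∀ {b} → S b → b ≉ a → P b) → Eventually P
  always p = 1# , 0<1 , λ b Sb b≉a _ → p Sb b≉a

  eventually₁ : ∀ {P Q : Pred ℝ 0ℓ} → (∀ {b} → S b → b ≉ a → P b → Q b) →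
                Eventually P → Eventually Q
  eventually₁ f (δ , 0<δ , p) = δ , 0<δ , λ b Sb b≉a near → f Sb b≉a (p b Sb b≉a near)

  eventually₂ : ∀ {P Q T : Pred ℝ 0ℓ} → (∀ {b} → S b → b ≉ a → P b → Q b → T b) →
                Eventually P → Eventually Q → Eventually T
  eventually₂ f (δ , 0<δ , p) (η , 0<η , q) =
    let (θ , 0<θ , θ≤δ , θ≤η) = min₂ 0<δ 0<η in
    θ , 0<θ , λ b Sb b≉a near →
      f Sb b≉a (p b Sb b≉a (<-≤-trans near θ≤δ)) (q b Sb b≉a (<-≤-trans near θ≤η))

  record Lim (φ : ℝ → ℝ) (d : ℝ) : Set where
    constructor lim
    field tends : ∀ ε → 0# < ε → Eventually λ b → abs (φ b - d) < ε
  open Lim public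

  lim-cong : ∀ {φ ψ d e} → Eventually (λ b → φ b ≈ ψ b) → d ≈ e → Lim φ d → Lim ψ e
  tends (lim-cong φ≈ψ d≈e φ→d) ε 0<ε =
    eventually₂ (λ _ _ eq near → <-respˡ-≈ (abs-cong (+-cong eq (-‿cong d≈e))) near) φ≈ψ (tends φ→d ε 0<ε)

  lim-const : ∀ d → Lim (λ _ → d) d
  tends (lim-const d) ε 0<ε = always λ _ _ → <-respˡ-≈ (sym (abs-0 (-‿inverseʳ d))) 0<ε

  lim-id : Lim (λ b → b) a
  tends lim-id ε 0<ε = ε , 0<ε , λ _ _ _ near → near

  lim-+ : ∀ {φ ψ d e} → Lim φ d → Lim ψ e → Lim (λ b → φ b + ψ b) (d + e)
  tends (lim-+ {φ} {ψ} {d} {e} p q) ε 0<ε =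
    eventually₂ (λ {b} _ _ P Q → ≤-<-trans
        (≤-trans (≈⇒≤ (abs-cong (solve 4 (λ x y d e → (x :+ y) :- (d :+ e) := (x :- d) :+ (y :- e)) refl (φ b) (ψ b) d e)))
                 (abs-+ (φ b - d) (ψ b - e)))
        (<-respʳ-≈ (half+half ε) (+-mono-< P Q)))
      (tends p (half ε) (half-pos 0<ε)) (tends q (half ε) (half-pos 0<ε))

  lim-bounded : ∀ {φ : ℝ → ℝ} {d} → Lim φ d → Eventually (λ b → abs (φ b) ≤ abs d + 1#)
  lim-bounded {φ} {d} p = eventually₁
    (λ {b} _ _ near → ≤-trans
      (≤-trans (≈⇒≤ (abs-cong (solve 2 (λ x d → x := d :+ (x :- d)) refl (φ b) d))) (abs-+ d (φ b - d)))
      (+-mono-≤ ≤-refl (<⇒≤ near)))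
    (tends p 1# 0<1)

  -- The limits of products and of inverses reduce to this: their errors are built from a null
  -- function times a bounded one. The tolerance `ε * M ⁻¹` compensates for the bound.
  lim-null-* : ∀ {φ ψ : ℝ → ℝ} {M} → 0# < M → Lim φ 0# → Eventually (λ b → abs (ψ b) ≤ M) → Lim (λ b → φ b * ψ b) 0#
  tends (lim-null-* {φ} {ψ} {M} 0<M p q) ε 0<ε =
    eventually₂ (λ {b} _ _ P Q → begin-strict
        abs (φ b * ψ b - 0#)           ≈⟨ abs-cong (solve 1 (λ x → x :- con (+ 0) := x) refl (φ b * ψ b)) ⟩
        abs (φ b * ψ b)                ≈⟨ abs-* (φ b) (ψ b) ⟩
        abs (φ b) * abs (ψ b)          ≤⟨ *-monoʳ-≤ (0≤abs (φ b)) Q ⟩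
        abs (φ b) * M                  ≈⟨ *-congʳ (abs-cong (solve 1 (λ x → x :- con (+ 0) := x) refl (φ b))) ⟨
        abs (φ b - 0#) * M             <⟨ *-monoˡ-< 0<M P ⟩
        (ε * M ⁻¹) * M                 ≈⟨ *-assoc _ _ _ ⟩
        ε * (M ⁻¹ * M)                 ≈⟨ *-congˡ (⁻¹-inverseˡ (>⇒≉0 0<M)) ⟩
        ε * 1#                         ≈⟨ *-identityʳ ε ⟩
        ε                              ∎)
      (tends p (ε * M ⁻¹) (*-pos 0<ε (⁻¹-pos 0<M))) q
    where open ≤-Reasoning

  abs+1-pos : ∀ x → 0# < abs x + 1#
  abs+1-pos x = <-respʳ-≈ (+-comm 1# (abs x)) (+-pos-nonNeg 0<1 (0≤abs x))

  lim-error : ∀ {φ d} → Lim φ d → Lim (λ b → φ b - d) 0#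
  lim-error {φ} {d} p = lim-cong (always λ _ _ → refl) (-‿inverseʳ d) (lim-+ p (lim-const (- d)))

  lim-from-error : ∀ {φ d} → Lim (λ b → φ b - d) 0# → Lim φ d
  lim-from-error {φ} {d} p =
    lim-cong (always λ {b} _ _ → solve 2 (λ x d → (x :- d) :+ d := x) refl (φ b) d) (+-identityˡ d) (lim-+ p (lim-const d))

  lim-* : ∀ {φ ψ d e} → Lim φ d → Lim ψ e → Lim (λ b → φ b * ψ b) (d * e)
  lim-* {φ} {ψ} {d} {e} p q = lim-from-error (lim-cong
    (always λ {b} _ _ → solve 4 (λ x y d e → (x :- d) :* y :+ (y :- e) :* d := x :* y :- d :* e) refl (φ b) (ψ b) d e)
    (+-identityˡ 0#)
    (lim-+ (lim-null-* {ψ = ψ} (abs+1-pos e) (lim-error p) (lim-bounded q))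
           (lim-null-* {ψ = λ _ → d} (abs+1-pos d) (lim-error q) (lim-bounded (lim-const d)))))

  lim-≉0 : ∀ {φ d} → d ≉ 0# → Lim φ d → Eventually (λ b → half (abs d) < abs (φ b))
  lim-≉0 d≉0 p = eventually₁ (λ _ _ → half-abs<) (tends p _ (half-pos (0<abs d≉0)))

  lim-⁻¹ : ∀ {φ d} → d ≉ 0# → Lim φ d → Lim (λ b → φ b ⁻¹) (d ⁻¹)
  lim-⁻¹ {φ} {d} d≉0 p = lim-from-error (lim-cong
    (eventually₁ (λ {b} _ _ far → sym (difference (abs>⇒≉0 far))) (lim-≉0 d≉0 p))
    (zeroˡ _)
    (lim-* (lim-null-* {ψ = λ b → φ b ⁻¹} (⁻¹-pos (half-pos (0<abs d≉0))) (lim-error p)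
             (eventually₁ (λ _ _ far → abs-⁻¹-≤ (half-pos (0<abs d≉0)) (<⇒≤ far)) (lim-≉0 d≉0 p)))
           (lim-const (- (d ⁻¹)))))
    where
    abs>⇒≉0 : ∀ {x} → half (abs d) < abs x → x ≉ 0#
    abs>⇒≉0 far x≈0 = <-irrefl (sym (abs-0 x≈0)) (<-trans (half-pos (0<abs d≉0)) far)
    difference : ∀ {x} → x ≉ 0# → x ⁻¹ - d ⁻¹ ≈ ((x - d) * x ⁻¹) * - (d ⁻¹)
    difference {x} x≉0 = begin
      x ⁻¹ - d ⁻¹                             ≈⟨ +-cong (*-identityʳ _) (-‿cong (*-identityʳ _)) ⟨
      x ⁻¹ * 1# - d ⁻¹ * 1#                   ≈⟨ +-cong (*-congˡ (⁻¹-inverseʳ d≉0)) (-‿cong (*-congˡ (⁻¹-inverseʳ x≉0))) ⟨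
      x ⁻¹ * (d * d ⁻¹) - d ⁻¹ * (x * x ⁻¹)   ≈⟨ solve 4 (λ x d x′ d′ → x′ :* (d :* d′) :- d′ :* (x :* x′) := ((x :- d) :* x′) :* :- d′) refl x d (x ⁻¹) (d ⁻¹) ⟩
      ((x - d) * x ⁻¹) * - (d ⁻¹)             ∎
      where open import Relation.Binary.Reasoning.Setoid setoid

  record Deriv (f : ℝ → ℝ) (d : ℝ) : Set where
    constructor deriv
    field quotient-lim : Lim (λ b → (f b - f a) * (b - a) ⁻¹) d
  open Deriv public

  hasDerivative⇒deriv : ∀ {f d} → HasDerivative S f a d → Deriv f d
  hasDerivative⇒deriv p = deriv (lim p)

  deriv⇒hasDerivative : ∀ {f d} → Deriv f d → HasDerivative S f a d
  deriv⇒hasDerivative p = tends (quotient-lim p)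

  increment : ∀ {x b} → b ≉ a → (x * (b - a) ⁻¹) * (b - a) ≈ x
  increment b≉a = trans (*-assoc _ _ _) (trans (*-congˡ (⁻¹-inverseˡ (x-y≉0 b≉a))) (*-identityʳ _))

  deriv⇒lim : ∀ {f d} → Deriv f d → Lim f (f a)
  deriv⇒lim {f} {d} p = lim-cong
    (always λ {b} _ b≉a → trans (+-congʳ (increment b≉a)) (solve 2 (λ x y → (x :- y) :+ y := x) refl (f b) (f a)))
    (trans (+-congʳ (zeroʳ d)) (+-identityˡ (f a)))
    (lim-+ (lim-* (quotient-lim p) (lim-error lim-id)) (lim-const (f a)))

  deriv-cong : ∀ {f g d e} → (∀ {b} → S b → f b ≈ g b) → f a ≈ g a → d ≈ e → Deriv f d → Deriv g e
  deriv-cong f≈g fa≈ga d≈e p =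
    deriv (lim-cong (always λ Sb _ → *-congʳ (+-cong (f≈g Sb) (-‿cong fa≈ga))) d≈e (quotient-lim p))

  deriv-congʳ : ∀ {f d e} → d ≈ e → Deriv f d → Deriv f e
  deriv-congʳ = deriv-cong (λ _ → refl) refl

  deriv-const : ∀ c → Deriv (λ _ → c) 0#
  deriv-const c = deriv (lim-cong
    (always λ _ _ → sym (trans (*-congʳ (-‿inverseʳ c)) (zeroˡ _))) refl (lim-const 0#))

  deriv-+ : ∀ {f g d e} → Deriv f d → Deriv g e → Deriv (λ b → f b + g b) (d + e)
  deriv-+ {f} {g} p q = deriv (lim-cong
    (always λ {b} _ _ → solve 5 (λ x y x₀ y₀ i → (x :- x₀) :* i :+ (y :- y₀) :* i := ((x :+ y) :- (x₀ :+ y₀)) :* i) refl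
      (f b) (g b) (f a) (g a) ((b - a) ⁻¹))
    refl (lim-+ (quotient-lim p) (quotient-lim q)))

  deriv-* : ∀ {f g d e} → Deriv f d → Deriv g e → Deriv (λ b → f b * g b) (d * g a + f a * e)
  deriv-* {f} {g} {d} {e} p q = deriv (lim-cong
    (always λ {b} _ _ → solve 5 (λ x y x₀ y₀ i → ((x :- x₀) :* i) :* y₀ :+ x :* ((y :- y₀) :* i) := (x :* y :- x₀ :* y₀) :* i) refl
      (f b) (g b) (f a) (g a) ((b - a) ⁻¹))
    refl (lim-+ (lim-* (quotient-lim p) (lim-const (g a))) (lim-* (deriv⇒lim p) (quotient-lim q))))

  deriv-*ˡ : ∀ {f d} c → Deriv f d → Deriv (λ b → c * f b) (c * d)
  deriv-*ˡ {f} {d} c p = deriv-congʳ (trans (+-congʳ (zeroˡ (f a))) (+-identityˡ _)) (deriv-* (deriv-const c) p)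

  deriv-⁻¹ : ∀ {f d} → (∀ {b} → S b → f b ≉ 0#) → f a ≉ 0# → Deriv f d →
             Deriv (λ b → f b ⁻¹) (- (d * (f a ⁻¹ * f a ⁻¹)))
  deriv-⁻¹ {f} {d} f≉0 fa≉0 p = deriv (lim-cong
    (always λ {b} Sb _ → quotient (f≉0 Sb))
    (solve 2 (λ d i → :- d :* (i :* i) := :- (d :* (i :* i))) refl d (f a ⁻¹))
    (lim-* (lim-cong (always λ _ _ → refl) (*-identityˡ _) (lim-* (lim-const 1#) lim-neg))
           (lim-* (lim-⁻¹ fa≉0 (deriv⇒lim p)) (lim-const (f a ⁻¹)))))
    where
    lim-neg : Lim (λ b → - ((f b - f a) * (b - a) ⁻¹)) (- d)
    lim-neg = lim-cong (always λ {b} _ _ → solve 1 (λ x → :- con (+ 1) :* x := :- x) refl ((f b - f a) * (b - a) ⁻¹))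
      (solve 1 (λ x → :- con (+ 1) :* x := :- x) refl d) (lim-* (lim-const (- 1#)) (quotient-lim p))
    quotient : ∀ {x i} → x ≉ 0# → (1# * - ((x - f a) * i)) * (x ⁻¹ * f a ⁻¹) ≈ (x ⁻¹ - f a ⁻¹) * i
    quotient {x} {i} x≉0 = begin
      (1# * - ((x - y) * i)) * (x ⁻¹ * y ⁻¹)
        ≈⟨ solve 5 (λ x x′ y y′ i → (con (+ 1) :* :- ((x :- y) :* i)) :* (x′ :* y′)
                                    := (x′ :* (y :* y′) :- y′ :* (x :* x′)) :* i) refl x (x ⁻¹) y (y ⁻¹) i ⟩
      (x ⁻¹ * (y * y ⁻¹) - y ⁻¹ * (x * x ⁻¹)) * i
        ≈⟨ *-congʳ (+-cong (*-congˡ (⁻¹-inverseʳ fa≉0)) (-‿cong (*-congˡ (⁻¹-inverseʳ x≉0)))) ⟩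
      (x ⁻¹ * 1# - y ⁻¹ * 1#) * i
        ≈⟨ *-congʳ (+-cong (*-identityʳ _) (-‿cong (*-identityʳ _))) ⟩
      (x ⁻¹ - y ⁻¹) * i ∎
      where
      open import Relation.Binary.Reasoning.Setoid setoid
      y = f a

  -- At an isolated point of `S` every number is vacuously a limit; uniqueness therefore asks that
  -- `a` be an accumulation point.
  module _ (acc : ∀ δ → 0# < δ → ∃ λ b → S b × b ≉ a × abs (b - a) < δ) where

    lim-unique : ∀ {φ d e} → Lim φ d → Lim φ e → d ≈ e
    lim-unique {φ} {d} {e} p q = x∙y⁻¹≈ε⇒x≈y _ _ (abs<⇒≈0 λ ε 0<ε →
      let (δ , 0<δ , r) = eventually₂ (λ {b} _ _ P Q → <-triangle {ε = ε} (≤-<-trans (≈⇒≤ (abs-swap d (φ b))) P) Q)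
                            (tends p (half ε) (half-pos 0<ε)) (tends q (half ε) (half-pos 0<ε))
          (b , Sb , b≉a , near) = acc δ 0<δ
      in r b Sb b≉a near)

    deriv-unique : ∀ {f d e} → Deriv f d → Deriv f e → d ≈ e
    deriv-unique p q = lim-unique (quotient-lim p) (quotient-lim q)

-- Mean value inequality, chain rule and symmetry of mixed partials

length-word : ∀ s l → length (replicate s 𝕩 ++ replicate l 𝕪) ≡ s ℕ.+ l
length-word s l = ≡.trans (length-++ (replicate s 𝕩)) (≡.cong₂ ℕ._+_ (length-replicate s) (length-replicate l))

module MeanValue (em : ExcludedMiddle 0ℓ) (R : CompleteOrderedField) where

  open CompleteOrderedField R
  open Calculus R
  open IntegerSolver commutativeRing
  open OrderedField R

  x<x+y : ∀ {x y} → 0# < y → x < x + y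
  x<x+y {x} {y} p = <-by p (solve 2 (λ x y → y := x :+ y :- x) refl x y)

  x-y<x : ∀ {x y} → 0# < y → x - y < x
  x-y<x {x} {y} p = <-by p (solve 2 (λ x y → y := x :- (x :- y)) refl x y)

  abs-≤-diff : ∀ {s t} → s ≤ t → abs (t - s) ≈ t - s
  abs-≤-diff s≤t = abs-nonNeg (x≤y⇒0≤y-x s≤t)

  self-near : ∀ {δ} x → 0# < δ → abs (x - x) < δ
  self-near x 0<δ = <-respˡ-≈ (sym (abs-0 (-‿inverseʳ x))) 0<δ

  -- Let z be the supremum of the points reached from u. Some reached point lies so close below z
  -- that the local hypothesis at z carries the relation on to z; if z were less than v, it would
  -- carry it beyond z, against the choice of z.
  interval-induction : ∀ {u v} (_∼_ : Rel ℝ 0ℓ) → u ≤ v → Transitive _∼_ →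
    (∀ t → u ≤ t → t ≤ v → ∃ λ δ → 0# < δ ×
       (∀ s → u ≤ s → s ≤ v → abs (s - t) < δ → (s ≤ t → s ∼ t) × (t ≤ s → t ∼ s))) →
    u ∼ v
  interval-induction {u} {v} _∼_ u≤v ∼-trans local = conclude (supremum Reached (u , u-reached) (v , λ (_ , t≤v , _) → t≤v))
    where
    Reached : Pred ℝ 0ℓ
    Reached t = u ≤ t × t ≤ v × u ∼ t

    u-reached : Reached u
    u-reached = let (δ , 0<δ , near) = local u ≤-refl u≤v in
      -- Reflexivity at u is the local hypothesis with both points equal to u.
      ≤-refl , u≤v , proj₁ (near u ≤-refl u≤v (self-near u 0<δ)) ≤-refl

    conclude : (∃ λ z → UpperBound Reached z × (∀ {w} → UpperBound Reached w → z ≤ w)) → u ∼ v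
    conclude (z , ub , least) with ub u-reached | least (λ (_ , t≤v , _) → t≤v)
    ... | u≤z | z≤v with local z u≤z z≤v
    -- If no reached point exceeded z - δ, this number would be a smaller upper bound.
    ... | δ , 0<δ , near with em {∃ λ t → Reached t × z - δ < t}
    ... | no ¬t = ⊥-elim (<⇒≱ (x-y<x 0<δ) (least λ {x} Rx → ≮⇒≥ λ z-δ<x → ¬t (x , Rx , z-δ<x)))
    ... | yes (t , Rt@(u≤t , t≤v , u∼t) , z-δ<t) = beyond (compare z v)
      where
      t-near : abs (t - z) < δ
      t-near = <-respˡ-≈ (trans (sym (abs-≤-diff (ub Rt))) (abs-swap z t))
        (<-by (x<y⇒0<y-x z-δ<t) (solve 3 (λ z d t → t :- (z :- d) := d :- (z :- t)) refl z δ t))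

      u∼z : u ∼ z
      u∼z = ∼-trans u∼t (proj₁ (near t u≤t t≤v t-near) (ub Rt))

      beyond : Tri (z < v) (z ≈ v) (v < z) → u ∼ v
      beyond (tri> _ _ v<z) = ⊥-elim (<⇒≱ v<z z≤v)
      beyond (tri≈ _ z≈v _) = ∼-trans u∼z (proj₂ (near v u≤v ≤-refl
        (<-respˡ-≈ (sym (abs-0 (x≈y⇒x∙y⁻¹≈ε (sym z≈v)))) 0<δ)) (≈⇒≤ z≈v))
      -- Half of δ keeps z + η strictly within δ of z, and v - z keeps it inside the interval.
      beyond (tri< z<v _ _) with min₂ (half-pos 0<δ) (x<y⇒0<y-x z<v)
      ... | η , 0<η , η≤δ/2 , η≤v-z =
        ⊥-elim (<⇒≱ (x<x+y 0<η) (ub (u≤s , s≤v , ∼-trans u∼z (proj₂ (near s u≤s s≤v s-near) z≤s))))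
        where
        s = z + η
        z≤s : z ≤ s
        z≤s = <⇒≤ (x<x+y 0<η)
        u≤s : u ≤ s
        u≤s = ≤-trans u≤z z≤s
        s≤v : s ≤ v
        s≤v = ≤-by (x≤y⇒0≤y-x η≤v-z) (solve 3 (λ v z e → v :- z :- e := v :- (z :+ e)) refl v z η)
        s-near : abs (s - z) < δ
        s-near = ≤-<-trans (≈⇒≤ (trans (abs-≤-diff z≤s) (solve 2 (λ z e → z :+ e :- z := e) refl z η)))
                   (≤-<-trans η≤δ/2 (half-< 0<δ))

  quotient-error : ∀ {x c h} → h ≉ 0# → (x * h ⁻¹ - c) * h ≈ x - c * h
  quotient-error {x} {c} {h} h≉0 = begin
    (x * h ⁻¹ - c) * h         ≈⟨ solve 4 (λ x h′ c h → (x :* h′ :- c) :* h := x :* (h′ :* h) :- c :* h) refl x (h ⁻¹) c h ⟩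
    x * (h ⁻¹ * h) - c * h     ≈⟨ +-congʳ (trans (*-congˡ (⁻¹-inverseˡ h≉0)) (*-identityʳ x)) ⟩
    x - c * h                  ∎
    where open import Relation.Binary.Reasoning.Setoid setoid

  -- Bounds on difference quotients do not add up along consecutive intervals; after multiplication
  -- by the length they do.
  quotient⇒linear : ∀ {x c h ε} → h ≉ 0# → abs (x * h ⁻¹ - c) ≤ ε → abs (x - c * h) ≤ ε * abs h
  quotient⇒linear h≉0 p = ≤-trans
    (≈⇒≤ (trans (abs-cong (sym (quotient-error h≉0))) (abs-* _ _))) (*-monoˡ-≤ (0≤abs _) p)

  linear⇒quotient : ∀ {x c h ε} → h ≉ 0# → abs (x - c * h) ≤ ε * abs h → abs (x * h ⁻¹ - c) ≤ ε
  linear⇒quotient h≉0 p = *-cancelʳ-≤ (0<abs h≉0)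
    (≤-trans (≈⇒≤ (sym (trans (abs-cong (sym (quotient-error h≉0))) (abs-* _ _)))) p)

  module _ {S : Pred ℝ 0ℓ} {f f′ : ℝ → ℝ} (f-resp : RespectsEqualityOn S f) {c ε : ℝ} where

    -- The bound is additive over adjacent intervals, hence a transitive relation between their
    -- endpoints, and differentiability gives it locally. No intermediate point has to be found, and
    -- `c` may be any number close to all the derivatives.
    mean-value-≤ : ∀ {u v} → u ≤ v →
      (∀ s → u ≤ s → s ≤ v → S s × HasDerivative S f s (f′ s) × abs (f′ s - c) < ε) →
      abs ((f v - f u) - c * (v - u)) ≤ ε * (v - u)
    mean-value-≤ {u} {v} u≤v hyp = interval-induction _∼_ u≤v ∼-trans local
      where
      _∼_ : Rel ℝ 0ℓ
      s ∼ t = abs ((f t - f s) - c * (t - s)) ≤ ε * (t - s)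
      ∼-trans : Transitive _∼_
      ∼-trans {r} {s} {t} p q = ≤-trans
        (≤-trans (≈⇒≤ (abs-cong (solve 7 (λ x y z c r s t → (z :- x) :- c :* (t :- r) :=
                   ((y :- x) :- c :* (s :- r)) :+ ((z :- y) :- c :* (t :- s))) refl (f r) (f s) (f t) c r s t)))
                 (abs-+ _ _))
        (≤-respʳ-≈ (solve 4 (λ e r s t → e :* (s :- r) :+ e :* (t :- s) := e :* (t :- r)) refl ε r s t)
          (+-mono-≤ p q))
      local : ∀ t → u ≤ t → t ≤ v → ∃ λ δ → 0# < δ ×
       (∀ s → u ≤ s → s ≤ v → abs (s - t) < δ → (s ≤ t → s ∼ t) × (t ≤ s → t ∼ s))
      local t u≤t t≤v with hyp t u≤t t≤v
      -- The tolerance is the slack in the strict inequality, so the difference quotients near t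
      -- stay within ε of c.
      ... | St , f-deriv , f′≈c with f-deriv (ε - abs (f′ t - c)) (x<y⇒0<y-x f′≈c)
      ... | δ , 0<δ , close = δ , 0<δ , λ s u≤s s≤v near →
        (λ s≤t → ≤-trans
            (≈⇒≤ (trans (sym (abs-neg _)) (abs-cong (solve 5 (λ x y c s t → :- ((x :- y) :- c :* (t :- s)) := (y :- x) :- c :* (s :- t))
               refl (f t) (f s) c s t))))
            (≤-trans (bound s u≤s s≤v near) (≈⇒≤ (*-congˡ (trans (abs-swap s t) (abs-≤-diff s≤t)))))) ,
        (λ t≤s → ≤-trans (bound s u≤s s≤v near) (≈⇒≤ (*-congˡ (abs-≤-diff t≤s))))
        where
        bound : ∀ s → u ≤ s → s ≤ v → abs (s - t) < δ → abs ((f s - f t) - c * (s - t)) ≤ ε * abs (s - t)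
        bound s u≤s s≤v near with s ≈? t
        ... | yes s≈t = ≈⇒≤ (trans
          (abs-0 (trans (+-cong (x≈y⇒x∙y⁻¹≈ε (f-resp (proj₁ (hyp s u≤s s≤v)) St s≈t))
                                (-‿cong (trans (*-congˡ (x≈y⇒x∙y⁻¹≈ε s≈t)) (zeroʳ c))))
                        (-‿inverseʳ 0#)))
          (sym (trans (*-congˡ (abs-0 (x≈y⇒x∙y⁻¹≈ε s≈t))) (zeroʳ ε))))
        ... | no s≉t = quotient⇒linear (x-y≉0 s≉t) (<⇒≤ (≤-<-trans (triangle _ (f′ t) c)
          (<-respʳ-≈ (solve 2 (λ e x → x :+ (e :- x) := e) refl ε (abs (f′ t - c)))
            (<-respˡ-≈ (+-comm _ _) (+-mono-≤-< ≤-refl (close s (proj₁ (hyp s u≤s s≤v)) s≉t near))))))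

    mean-value : ∀ {a δ} →
      (∀ s → abs (s - a) < δ → S s × HasDerivative S f s (f′ s) × abs (f′ s - c) < ε) →
      ∀ {t} → abs (t - a) < δ → abs ((f t - f a) - c * (t - a)) ≤ ε * abs (t - a)
    mean-value {a} {δ} hyp {t} near with ≤.total compare a t
    ... | inj₁ a≤t = ≤-trans (mean-value-≤ a≤t λ s a≤s s≤t → hyp s (≤-<-trans
             (≤-trans (≈⇒≤ (abs-≤-diff a≤s)) (≤-trans (+-mono-≤ s≤t ≤-refl) (x≤abs _))) near))
             (≈⇒≤ (*-congˡ (sym (abs-≤-diff a≤t))))
    ... | inj₂ t≤a = ≤-trans
             (≈⇒≤ (trans (sym (abs-neg _)) (abs-cong (solve 5 (λ x y c s t → :- ((x :- y) :- c :* (t :- s)) := (y :- x) :- c :* (s :- t))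
               refl (f t) (f a) c a t))))
             (≤-trans (mean-value-≤ t≤a λ s t≤s s≤a → hyp s (≤-<-trans
               (≤-trans (≈⇒≤ (trans (abs-swap s a) (abs-≤-diff s≤a))) (≤-trans (+-mono-≤ ≤-refl (neg-mono-≤ t≤s)) (≤-trans (x≤abs _) (≈⇒≤ (abs-swap a t))))) near))
             (≈⇒≤ (*-congˡ (sym (trans (abs-swap t a) (abs-≤-diff t≤a))))))

  -- Functions on the setoid of reals need not respect its equality. Continuity enforces it, since
  -- equal points are nearer than every δ.
  continuous-resp : ∀ {U : Pred ℝ² 0ℓ} {G} → ContinuousOn U G → ∀ {a b a′ b′} → U (a , b) → U (a′ , b′) → a ≈ a′ → b ≈ b′ → G (a , b) ≈ G (a′ , b′)
  continuous-resp cont Up Uq a≈a′ b≈b′ = sym (x∙y⁻¹≈ε⇒x≈y _ _ (abs<⇒≈0 λ ε 0<ε →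
    let (δ , 0<δ , close) = cont Up ε 0<ε in
    close _ Uq ( <-respˡ-≈ (sym (abs-0 (x≈y⇒x∙y⁻¹≈ε (sym a≈a′)))) 0<δ
               , <-respˡ-≈ (sym (abs-0 (x≈y⇒x∙y⁻¹≈ε (sym b≈b′)))) 0<δ)))

  open-accumulates : ∀ {S : Pred ℝ 0ℓ} {a} → (∃ λ ε → 0# < ε × (∀ b → abs (b - a) < ε → S b)) →
                     ∀ δ → 0# < δ → ∃ λ b → S b × b ≉ a × abs (b - a) < δ
  open-accumulates {S} {a} (ε , 0<ε , ball) δ 0<δ with min₂ (half-pos 0<ε) (half-pos 0<δ)
  ... | h , 0<h , h≤ε/2 , h≤δ/2 = a + h , ball _ (near 0<ε h≤ε/2) , (λ eq → <⇒≉ (x<x+y 0<h) (sym eq)) , near 0<δ h≤δ/2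
    where
    near : ∀ {η} → 0# < η → h ≤ half η → abs ((a + h) - a) < η
    near 0<η h≤ = ≤-<-trans (≤-trans (≈⇒≤ (trans (abs-≤-diff (<⇒≤ (x<x+y 0<h))) (solve 2 (λ a h → a :+ h :- a := h) refl a h))) h≤) (half-< 0<η)

  hasPartial-unique : ∀ {U} → Open² U → ∀ v {f g : ℝ² → ℝ} → (∀ {q} → U q → f q ≈ g q) →
                      ∀ {p d e} → U p → HasPartial U v f p d → HasPartial U v g p e → d ≈ e
  hasPartial-unique {U} U-open 𝕩 f≈g {a , b} Up p q = deriv-unique
    (open-accumulates (let (ε , 0<ε , box) = U-open Up in ε , 0<ε , λ s near → box (s , b) (near , self-near b 0<ε)))
    (deriv-cong f≈g (f≈g Up) refl (hasDerivative⇒deriv p)) (hasDerivative⇒deriv q)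
    where open Limits R (λ t → U (t , b)) a
  hasPartial-unique {U} U-open 𝕪 f≈g {a , b} Up p q = deriv-unique
    (open-accumulates (let (ε , 0<ε , box) = U-open Up in ε , 0<ε , λ s near → box (a , s) (self-near a 0<ε , near)))
    (deriv-cong f≈g (f≈g Up) refl (hasDerivative⇒deriv p)) (hasDerivative⇒deriv q)
    where open Limits R (λ t → U (a , t)) b

  -- Chain rule along the graph of a function

  module ChainRule
    {U : Pred ℝ² 0ℓ} (U-open : Open² U) {G Gx : ℝ² → ℝ} {gy : ℝ}
    (G-cont : ContinuousOn U G) (Gx-cont : ContinuousOn U Gx)
    (G-partial : ∀ {q} → U q → HasPartial U 𝕩 G q (Gx q))
    {J : Pred ℝ 0ℓ} {y : ℝ → ℝ} (graph : ∀ {t} → J t → U (t , y t))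
    {a : ℝ} (Ja : J a) (G-partial-y : HasPartial U 𝕪 G (a , y a) gy)
    where

    open Limits R J a

    private

      p : ℝ²
      p = a , y a

      -- The difference quotient in the second variable, filled in by its limit wherever y returns
      -- to the value y a. Such points may accumulate at a, and there the quotient would divide by
      -- 0.
      slope : ℝ → ℝ
      slope t with y t ≈? y a
      ... | yes _ = gy
      ... | no  _ = (G (a , y t) - G (a , y a)) * (y t - y a) ⁻¹

      module _ {d} (y-deriv : Deriv y d) where

        y-near : ∀ ε → 0# < ε → Eventually λ t → abs (y t - y a) < ε
        y-near = tends (deriv⇒lim y-deriv)

        both-near : ∀ ε → 0# < ε → Eventually λ t → abs (t - a) < ε × abs (y t - y a) < ε
        both-near ε 0<ε = eventually₂ (λ _ _ → _,_) (tends lim-id ε 0<ε) (y-near ε 0<ε)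

        slope-lim : Lim slope gy
        tends slope-lim ε 0<ε with U-open (graph Ja) | G-partial-y ε 0<ε
        ... | η , 0<η , box | δ , 0<δ , close = eventually₂ near (y-near η 0<η) (y-near δ 0<δ)
          where
          near : ∀ {t} → J t → t ≉ a → abs (y t - y a) < η → abs (y t - y a) < δ → abs (slope t - gy) < ε
          near {t} _ _ p q with y t ≈? y a
          ... | yes _  = self-near gy 0<ε
          ... | no y≉ = close (y t) (box (a , y t) (self-near a 0<η , p)) y≉ q

        -- The base height y t varies with t, so the partial derivative at p alone says nothing
        -- here. Continuity of `Gx` around p, fed into the mean value inequality, makes the estimate
        -- uniform in the height.
        increment-x : Lim (λ t → (G (t , y t) - G (a , y t)) * (t - a) ⁻¹) (Gx p)
        tends increment-x ε 0<ε with U-open (graph Ja) | Gx-cont (graph Ja) (half ε) (half-pos 0<ε)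
        ... | η , 0<η , box | δ , 0<δ , close with min₂ 0<η 0<δ
        ... | θ , 0<θ , θ≤η , θ≤δ = eventually₁ near (both-near θ 0<θ)
          where
          near : ∀ {t} → J t → t ≉ a → abs (t - a) < θ × abs (y t - y a) < θ →
                 abs ((G (t , y t) - G (a , y t)) * (t - a) ⁻¹ - Gx p) < ε
          near {t} _ t≉a (t-near , yt-near) = ≤-<-trans
            (linear⇒quotient (x-y≉0 t≉a) (mean-value {f′ = λ s → Gx (s , y t)}
              (λ Us Us′ s≈s′ → continuous-resp G-cont Us Us′ s≈s′ refl)
              (λ s s-near → let Us = box (s , y t) (<-≤-trans s-near θ≤η , <-≤-trans yt-near θ≤η) in
                 Us , G-partial Us , close (s , y t) Us (<-≤-trans s-near θ≤δ , <-≤-trans yt-near θ≤δ))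
              t-near))
            (half-< 0<ε)

        slope-increment : ∀ {t} → U (a , y t) → slope t * (y t - y a) ≈ G (a , y t) - G (a , y a)
        slope-increment {t} Ut with y t ≈? y a
        ... | yes y≈ = trans (trans (*-congˡ (x≈y⇒x∙y⁻¹≈ε y≈)) (zeroʳ gy))
                             (sym (x≈y⇒x∙y⁻¹≈ε (continuous-resp G-cont Ut (graph Ja) refl y≈)))
        ... | no y≉  = trans (*-assoc _ _ _) (trans (*-congˡ (⁻¹-inverseˡ (x-y≉0 y≉))) (*-identityʳ _))

    -- The increment of G is split at the corner (a, y t): the horizontal leg is `increment-x`, and
    -- the vertical leg is `slope` times the increment of y.
    chain-rule : ∀ {d} → Deriv y d → Deriv (λ t → G (t , y t)) (Gx p + gy * d)
    chain-rule {d} y-deriv = deriv (lim-cong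
      (let (η , 0<η , box) = U-open (graph Ja) in
       eventually₁ (λ {t} _ _ yt-near → begin
           (G (t , y t) - G (a , y t)) * (t - a) ⁻¹ + slope t * ((y t - y a) * (t - a) ⁻¹)
             ≈⟨ +-congˡ (trans (sym (*-assoc _ _ _)) (*-congʳ (slope-increment y-deriv (box (a , y t) (self-near a 0<η , yt-near))))) ⟩
           (G (t , y t) - G (a , y t)) * (t - a) ⁻¹ + (G (a , y t) - G (a , y a)) * (t - a) ⁻¹
             ≈⟨ solve 4 (λ x y z i → (x :- y) :* i :+ (y :- z) :* i := (x :- z) :* i) refl _ _ _ _ ⟩
           (G (t , y t) - G (a , y a)) * (t - a) ⁻¹ ∎)
         (y-near y-deriv η 0<η))
      refl
      (lim-+ (increment-x y-deriv) (lim-* (slope-lim y-deriv) (quotient-lim y-deriv))))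
      where open import Relation.Binary.Reasoning.Setoid setoid

  -- Second differences and symmetry of mixed partial derivatives

  module SecondDifference
    {S T : ℝ → Pred ℝ 0ℓ} {G G₂ G₁₂ : ℝ → ℝ → ℝ} {a b c δ ε : ℝ}
    (G-resp : ∀ s → RespectsEqualityOn (S s) (G s))
    (G₂-resp : ∀ t → RespectsEqualityOn (T t) (λ s → G₂ s t))
    (derivs : ∀ {s t} → abs (s - a) < δ → abs (t - b) < δ →
       (S s t × HasDerivative (S s) (G s) t (G₂ s t)) ×
       (T t s × HasDerivative (T t) (λ s → G₂ s t) s (G₁₂ s t)) × abs (G₁₂ s t - c) < half ε)
    (0<ε : 0# < ε) (0<δ : 0# < δ)
    where

    -- The mean value inequality is applied twice: in s to `G₂`, which shows that the t-derivative
    -- of G (a + h) t - G a t is close to c h, and then in t. The outer application wants a strict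
    -- bound ε h, which the tolerance `half ε` of the inner one supplies.
    second-difference : ∀ {h} → 0# < h → h < δ →
      abs (((G (a + h) (b + h) - G a (b + h)) - (G (a + h) b - G a b)) - c * (h * h)) ≤ ε * (h * h)
    second-difference {h} 0<h h<δ = begin
      abs (((G (a + h) (b + h) - G a (b + h)) - (G (a + h) b - G a b)) - c * (h * h))
        ≈⟨ abs-cong (+-congˡ (-‿cong (solve 3 (λ b c h → c :* (h :* h) := (c :* h) :* ((b :+ h) :- b)) refl b c h))) ⟩
      abs (((G (a + h) (b + h) - G a (b + h)) - (G (a + h) b - G a b)) - (c * h) * ((b + h) - b))
        ≤⟨ mean-value {S = λ t → S (a + h) t × S a t} {f = λ t → G (a + h) t - G a t}
             {f′ = λ t → G₂ (a + h) t - G₂ a t}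
             (λ (p , q) (p′ , q′) eq → +-cong (G-resp _ p p′ eq) (-‿cong (G-resp _ q q′ eq)))
             (λ t t-near → let (p , q) = proj₁ (derivs a+h-near t-near) , proj₁ (derivs (self-near a 0<δ) t-near) in
                (proj₁ p , proj₁ q) , difference-deriv t (proj₂ p) (proj₂ q) , inner t t-near)
             (shift-near b) ⟩
      (ε * h) * abs ((b + h) - b)   ≈⟨ *-congˡ (abs-shift b) ⟩
      (ε * h) * h                   ≈⟨ *-assoc _ _ _ ⟩
      ε * (h * h)                   ∎
      where
      open ≤-Reasoning

      abs-shift : ∀ x → abs ((x + h) - x) ≈ h
      abs-shift x = trans (abs-≤-diff (<⇒≤ (x<x+y 0<h))) (solve 2 (λ x h → x :+ h :- x := h) refl x h)

      shift-near : ∀ x → abs ((x + h) - x) < δ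
      shift-near x = ≤-<-trans (≈⇒≤ (abs-shift x)) h<δ

      a+h-near : abs ((a + h) - a) < δ
      a+h-near = shift-near a

      difference-deriv : ∀ t {d e} → HasDerivative (S (a + h)) (G (a + h)) t d → HasDerivative (S a) (G a) t e →
        HasDerivative (λ t → S (a + h) t × S a t) (λ t → G (a + h) t - G a t) t (d - e)
      difference-deriv t {d} {e} p q = deriv⇒hasDerivative (deriv-cong
        (λ {x} _ → +-congˡ (neg (G a x))) (+-congˡ (neg (G a t))) (+-congˡ (neg e))
        (deriv-+ (hasDerivative⇒deriv (λ η 0<η → let (θ , 0<θ , close) = p η 0<η in θ , 0<θ , λ x (Sx , _) → close x Sx))
          (deriv-*ˡ (- 1#) (hasDerivative⇒deriv (λ η 0<η → let (θ , 0<θ , close) = q η 0<η in θ , 0<θ , λ x (_ , Sx) → close x Sx)))))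
        where
        open Limits R (λ t → S (a + h) t × S a t) t
        neg : ∀ x → - 1# * x ≈ - x
        neg = solve 1 (λ x → :- con (+ 1) :* x := :- x) refl

      inner : ∀ t → abs (t - b) < δ → abs ((G₂ (a + h) t - G₂ a t) - c * h) < ε * h
      inner t t-near = begin-strict
        abs ((G₂ (a + h) t - G₂ a t) - c * h)
          ≈⟨ abs-cong (+-congˡ (-‿cong (*-congˡ (solve 2 (λ a h → h := a :+ h :- a) refl a h)))) ⟩
        abs ((G₂ (a + h) t - G₂ a t) - c * ((a + h) - a))
          ≤⟨ mean-value {f′ = λ s → G₁₂ s t} (G₂-resp t)
               (λ s s-near → let (Tt , d) , close = proj₂ (derivs s-near t-near) in Tt , d , close) a+h-near ⟩
        half ε * abs ((a + h) - a)  ≈⟨ *-congˡ (abs-shift a) ⟩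
        half ε * h                  <⟨ *-monoˡ-< 0<h (half-< 0<ε) ⟩
        ε * h                       ∎

  module _ {N U F} (U-open : Open² U) (C : ContDiff N U F) where

    open ContDiff C

    -- The second difference over a small square is symmetric in the two directions, and h² times
    -- either mixed derivative approximates it.
    clairaut : ∀ w → 2 ℕ.+ length w ℕ.≤ N → ∀ {p} → U p → ∂ (𝕪 ∷ 𝕩 ∷ w) p ≈ ∂ (𝕩 ∷ 𝕪 ∷ w) p
    clairaut w len {p@(a , b)} Up = x∙y⁻¹≈ε⇒x≈y _ _ (abs≤⇒≈0 close)
      where
      len₁ : suc (length w) ℕ.≤ N
      len₁ = ℕ.≤-trans (ℕ.n≤1+n _) len
      len₀ : length w ℕ.≤ N
      len₀ = ℕ.≤-trans (ℕ.n≤1+n _) len₁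
      cxy = ∂ (𝕩 ∷ 𝕪 ∷ w) p
      cyx = ∂ (𝕪 ∷ 𝕩 ∷ w) p
      close : ∀ ε → 0# < ε → abs (cyx - cxy) ≤ ε
      -- Each of the two second differences is allowed the error `half ε`, and `SecondDifference`
      -- asks for half of its own error once more.
      close ε 0<ε with U-open Up | ∂-continuous (𝕩 ∷ 𝕪 ∷ w) len Up (half (half ε)) (half-pos (half-pos 0<ε))
                               | ∂-continuous (𝕪 ∷ 𝕩 ∷ w) len Up (half (half ε)) (half-pos (half-pos 0<ε))
      ... | η , 0<η , box | δ₁ , 0<δ₁ , close₁ | δ₂ , 0<δ₂ , close₂ with min₂ 0<δ₁ 0<δ₂
      ... | δ₃ , 0<δ₃ , δ₃≤δ₁ , δ₃≤δ₂ with min₂ 0<η 0<δ₃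
      ... | δ , 0<δ , δ≤η , δ≤δ₃ = *-cancelʳ-≤ (*-pos 0<h 0<h) (begin
        abs (cyx - cxy) * (h * h)             ≈⟨ *-congˡ (abs-nonNeg (<⇒≤ (*-pos 0<h 0<h))) ⟨
        abs (cyx - cxy) * abs (h * h)         ≈⟨ abs-* _ _ ⟨
        abs ((cyx - cxy) * (h * h))           ≈⟨ abs-cong (solve 7 (λ p q r s x y k →
          (y :- x) :* k := (((p :- q) :- (r :- s)) :- x :* k) :+ :- (((p :- r) :- (q :- s)) :- y :* k))
          refl (∂ w (a + h , b + h)) (∂ w (a , b + h)) (∂ w (a + h , b)) (∂ w (a , b)) cxy cyx (h * h)) ⟩
        abs _                                 ≤⟨ abs-+ _ _ ⟩
        abs _ + abs (- _)                     ≤⟨ +-mono-≤ diff₁ (≤-trans (≈⇒≤ (abs-neg _)) diff₂) ⟩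
        half ε * (h * h) + half ε * (h * h)   ≈⟨ distribʳ _ _ _ ⟨
        (half ε + half ε) * (h * h)           ≈⟨ *-congʳ (half+half ε) ⟩
        ε * (h * h)                           ∎)
        where
        open ≤-Reasoning
        h = half δ
        0<h : 0# < h
        0<h = half-pos 0<δ
        in-U : ∀ {s t} → abs (s - a) < δ → abs (t - b) < δ → U (s , t)
        in-U p q = box _ (<-≤-trans p δ≤η , <-≤-trans q δ≤η)
        near₁ : ∀ {x} → x < δ → x < δ₁
        near₁ p = <-≤-trans p (≤-trans δ≤δ₃ δ₃≤δ₁)
        near₂ : ∀ {x} → x < δ → x < δ₂
        near₂ p = <-≤-trans p (≤-trans δ≤δ₃ δ₃≤δ₂)
        diff₁ = SecondDifference.second-difference
          {S = λ s t → U (s , t)} {T = λ t s → U (s , t)}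
          {G = λ s t → ∂ w (s , t)} {G₂ = λ s t → ∂ (𝕪 ∷ w) (s , t)} {G₁₂ = λ s t → ∂ (𝕩 ∷ 𝕪 ∷ w) (s , t)}
          {a = a} {b = b} {c = cxy}
          (λ s p q eq → continuous-resp (∂-continuous w len₀) p q refl eq)
          (λ t p q eq → continuous-resp (∂-continuous (𝕪 ∷ w) len₁) p q eq refl)
          (λ p q → (in-U p q , ∂-∷ 𝕪 w len₁ (in-U p q)) , (in-U p q , ∂-∷ 𝕩 (𝕪 ∷ w) len (in-U p q)) ,
                   close₁ _ (in-U p q) (near₁ p , near₁ q))
          (half-pos 0<ε) 0<δ 0<h (half-< 0<δ)
        diff₂ = SecondDifference.second-difference
          {S = λ t s → U (s , t)} {T = λ s t → U (s , t)}
          {G = λ t s → ∂ w (s , t)} {G₂ = λ t s → ∂ (𝕩 ∷ w) (s , t)} {G₁₂ = λ t s → ∂ (𝕪 ∷ 𝕩 ∷ w) (s , t)}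
          {a = b} {b = a} {c = cyx}
          (λ s p q eq → continuous-resp (∂-continuous w len₀) p q eq refl)
          (λ t p q eq → continuous-resp (∂-continuous (𝕩 ∷ w) len₁) p q refl eq)
          (λ q p → (in-U p q , ∂-∷ 𝕩 w len₁ (in-U p q)) , (in-U p q , ∂-∷ 𝕪 (𝕩 ∷ w) len (in-U p q)) ,
                   close₂ _ (in-U p q) (near₂ p , near₂ q))
          (half-pos 0<ε) 0<δ 0<h (half-< 0<δ)

    -- One exchange brings an x-derivative to the front. The inductive equality holds on all of the
    -- open set U, so both of its sides have the same x-derivative.
    ∂𝕪-mixed : ∀ s l → s ℕ.+ l ℕ.< N → ∀ {p} → U p → ∂ (𝕪 ∷ replicate s 𝕩 ++ replicate l 𝕪) p ≈ mixed s (suc l) p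
    ∂𝕪-mixed zero    l s+l<N Up = refl
    ∂𝕪-mixed (suc s) l s+l<N Up = trans (clairaut w len Up)
      (hasPartial-unique U-open 𝕩 (∂𝕪-mixed s l (ℕ.<-trans (ℕ.n<1+n _) s+l<N)) Up
        (∂-∷ 𝕩 (𝕪 ∷ w) len Up) (∂-∷ 𝕩 w′ len′ Up))
      where
      w = replicate s 𝕩 ++ replicate l 𝕪
      w′ = replicate s 𝕩 ++ replicate (suc l) 𝕪
      len : 2 ℕ.+ length w ℕ.≤ N
      len rewrite length-word s l = s+l<N
      len′ : suc (length w′) ℕ.≤ N
      len′ rewrite length-word s (suc l) | ℕ.+-suc s l = s+l<N

-- Sums over block types of set partitions

-- (s , l) is the type of a block with s small and l large elements.
Block : Set
Block = ℕ × ℕ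

-- A finite multiset of block types. It is kept as a list, and the functionals applied to it are
-- shown to be invariant under permutation.
Monomial : Set
Monomial = List Block

infixl 6 _⊕_

_⊕_ : Block → Variable → Block
(s , l) ⊕ 𝕩 = suc s , l
(s , l) ⊕ 𝕪 = s , suc l

⊕-comm : ∀ b v w → b ⊕ v ⊕ w ≡ b ⊕ w ⊕ v
⊕-comm b 𝕩 𝕩 = ≡.refl
⊕-comm b 𝕩 𝕪 = ≡.refl
⊕-comm b 𝕪 𝕩 = ≡.refl
⊕-comm b 𝕪 𝕪 = ≡.refl

unit : Variable → Block
unit v = (0 , 0) ⊕ v

size : Block → ℕ
size (s , l) = s ℕ.+ l

size-⊕ : ∀ b v → size (b ⊕ v) ≡ suc (size b)
size-⊕ b       𝕩 = ≡.refl
size-⊕ (s , l) 𝕪 = ℕ.+-suc s l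

degree : Monomial → Block
degree τ = ∑ℕ (map proj₁ τ) , ∑ℕ (map proj₂ τ)

-- In other words, τ is a vector partition of d: the lists of block types that set partitions of d
-- can have. This invariant accompanies every later congruence.
record Partitions (d : Block) (τ : Monomial) : Set where
  constructor _,_
  field
    nonempty : All (λ b → 1 ℕ.≤ size b) τ
    degree≡  : degree τ ≡ d

open Partitions

partitions-↭ : ∀ {d σ τ} → σ ↭ τ → Partitions d σ → Partitions d τ
partitions-↭ σ↭τ (ne , eq) = All-resp-↭ σ↭τ ne ,
  ≡.trans (≡.cong₂ _,_ (sum-↭ (Perm.↭-sym (↭-map⁺ proj₁ σ↭τ))) (sum-↭ (Perm.↭-sym (↭-map⁺ proj₂ σ↭τ)))) eq

partitions-⊕ : ∀ {d b σ} v → Partitions d (b ∷ σ) → Partitions (d ⊕ v) (b ⊕ v ∷ σ)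
partitions-⊕ {b = b} {σ} v (_ ∷ ne , eq) = ≡.subst (1 ℕ.≤_) (≡.sym (size-⊕ b v)) (ℕ.s≤s ℕ.z≤n) ∷ ne , lemma {σ = σ} v eq
  where
  lemma : ∀ {d b σ} v → degree (b ∷ σ) ≡ d → degree (b ⊕ v ∷ σ) ≡ d ⊕ v
  lemma 𝕩 ≡.refl = ≡.refl
  lemma 𝕪 ≡.refl = ≡.refl

partitions-unit : ∀ {d τ} v → Partitions d τ → Partitions (d ⊕ v) (unit v ∷ τ)
partitions-unit 𝕩 (ne , ≡.refl) = ℕ.s≤s ℕ.z≤n ∷ ne , ≡.refl
partitions-unit 𝕪 (ne , ≡.refl) = ℕ.s≤s ℕ.z≤n ∷ ne , ≡.refl

size-degree : ∀ τ → size (degree τ) ≡ ∑ℕ (map size τ)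
size-degree []            = ≡.refl
size-degree ((s , l) ∷ τ) = ≡.trans (lemma s _ l _) (≡.cong (s ℕ.+ l ℕ.+_) (size-degree τ))
  where
  open +-*-Solver
  lemma : ∀ a b c d → (a ℕ.+ b) ℕ.+ (c ℕ.+ d) ≡ (a ℕ.+ c) ℕ.+ (b ℕ.+ d)
  lemma = solve 4 (λ a b c d → (a :+ b) :+ (c :+ d) := (a :+ c) :+ (b :+ d)) ≡.refl

length≤size : ∀ {τ} → All (λ b → 1 ℕ.≤ size b) τ → length τ ℕ.≤ ∑ℕ (map size τ)
length≤size []       = ℕ.z≤n
length≤size (p ∷ ps) = ℕ.+-mono-≤ p (length≤size ps)

size+length≤ : ∀ {τ} → All (λ b → 1 ℕ.≤ size b) τ →
               All (λ b → size b ℕ.+ length τ ℕ.≤ suc (∑ℕ (map size τ))) τ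
size+length≤ [] = []
size+length≤ {b ∷ τ} (p ∷ ps) =
  ℕ.≤-trans (ℕ.≤-reflexive (ℕ.+-suc (size b) (length τ))) (ℕ.s≤s (ℕ.+-monoʳ-≤ (size b) (length≤size ps)))
  ∷ All.map (λ {b′} q → ℕ.≤-trans (ℕ.≤-reflexive (ℕ.+-suc (size b′) (length τ)))
                          (ℕ.s≤s (ℕ.≤-trans q (ℕ.+-monoˡ-≤ (∑ℕ (map size τ)) p))))
            (size+length≤ ps)

-- The other j blocks use up at least j of the m + j elements. Thus I (m, j + 1) involves
-- derivatives of order at most m, and can be differentiated once more when m < N.
block-size≤ : ∀ {m j τ} → Partitions (m , j) τ → length τ ≡ suc j → All (λ b → size b ℕ.≤ m) τ
block-size≤ {m} {j} {τ} (ne , ≡.refl) len = All.map (λ {b} q → ℕ.+-cancelʳ-≤ (suc j) (size b) m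
  (≡.subst₂ (λ x y → size b ℕ.+ x ℕ.≤ y) len
    (≡.trans (≡.cong suc (≡.sym (size-degree τ))) (≡.sym (ℕ.+-suc m j))) q))
  (size+length≤ ne)

large-singleton-or-heavy : ∀ b → 1 ℕ.≤ size b → (0 , 1) ≡ b ⊎ 2 ℕ.≤ proj₁ b ℕ.+ size b
large-singleton-or-heavy (zero  , suc zero)    _ = inj₁ ≡.refl
large-singleton-or-heavy (zero  , suc (suc l)) _ = inj₂ (ℕ.s≤s (ℕ.s≤s ℕ.z≤n))
large-singleton-or-heavy (suc s , l)           _ =
  inj₂ (ℕ.s≤s (ℕ.≤-trans (ℕ.s≤s ℕ.z≤n) (ℕ.≤-reflexive (≡.sym (ℕ.+-suc s (s ℕ.+ l))))))

-- When small elements count twice, every nonempty block other than a large singleton weighs at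
-- least 2.
large-singleton-or-few : ∀ {τ} → All (λ b → 1 ℕ.≤ size b) τ →
  Any ((0 , 1) ≡_) τ ⊎ length τ ℕ.+ length τ ℕ.≤ proj₁ (degree τ) ℕ.+ size (degree τ)
large-singleton-or-few [] = inj₂ ℕ.z≤n
large-singleton-or-few {b@(s , l) ∷ τ} (p ∷ ps) with large-singleton-or-heavy b p | large-singleton-or-few ps
... | inj₁ q | _      = inj₁ (here q)
... | inj₂ _ | inj₁ q = inj₁ (there q)
... | inj₂ q | inj₂ r = inj₂ (≡.subst₂ ℕ._≤_
    (solve 1 (λ n → con 2 :+ (n :+ n) := (con 1 :+ n) :+ (con 1 :+ n)) ≡.refl (length τ))
    (solve 4 (λ s l a b → (s :+ (s :+ l)) :+ (a :+ (a :+ b)) := (s :+ a) :+ ((s :+ a) :+ (l :+ b))) ≡.refl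
      s l (proj₁ (degree τ)) (proj₂ (degree τ)))
    (ℕ.+-mono-≤ q r))
  where open +-*-Solver

-- Without large singletons 2 (j + 1) ≤ 2 m + j, that is j + 2 ≤ 2 m. This is the origin of the
-- upper limit 2 n - 1 for the number of blocks.
few-blocks : ∀ {m j τ} → Partitions (m , j) τ → length τ ≡ suc j → m ℕ.+ m ℕ.≤ suc j → Any ((0 , 1) ≡_) τ
few-blocks {m} {j} (ne , ≡.refl) len m+m≤ with large-singleton-or-few ne
... | inj₁ p = p
... | inj₂ p = ⊥-elim (ℕ.1+n≰n (ℕ.+-cancelˡ-≤ (suc j) (suc j) j (ℕ.≤-trans
    (≡.subst (λ k → k ℕ.+ k ℕ.≤ m ℕ.+ (m ℕ.+ j)) len p)
    (ℕ.≤-trans (ℕ.≤-reflexive (≡.sym (ℕ.+-assoc m m j))) (ℕ.+-monoˡ-≤ j m+m≤)))))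

-- Operators on functionals of lists of block types

module Functionals {c ℓ} (A : CommutativeRing c ℓ) where

  open CommutativeRing A hiding (zero)
  open IntegerSolver A
  open import Algebra.Properties.Semiring.Mult semiring using () renaming (_×_ to _·_)
  open import Relation.Binary.Reasoning.Setoid setoid

  -- Each entry is singled out in turn, with the remaining entries in their old order. The lemmas
  -- below hand on a witness x ∷ σ ↭ τ, through which properties of τ reach x and σ.
  pickSum : ∀ {X : Set} → (X → List X → Carrier) → List X → Carrier
  pickSum H []      = 0#
  pickSum H (x ∷ τ) = H x τ + pickSum (λ y σ → H y (x ∷ σ)) τ

  Symmetric : ∀ {X : Set} → (List X → Carrier) → Set _
  Symmetric Φ = ∀ {σ τ} → σ ↭ τ → Φ σ ≈ Φ τ

  module _ {X : Set} where

    pickSum-cong : ∀ {H K : X → List X → Carrier} τ →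
                   (∀ x σ → x ∷ σ ↭ τ → H x σ ≈ K x σ) → pickSum H τ ≈ pickSum K τ
    pickSum-cong []      eq = refl
    pickSum-cong (x ∷ τ) eq = +-cong (eq x τ Perm.refl)
      (pickSum-cong τ λ y σ y∷σ↭τ → eq y (x ∷ σ) (Perm.trans (Perm.swap y x Perm.refl) (Perm.prep x y∷σ↭τ)))

    pickSum-0 : ∀ {H : X → List X → Carrier} τ → (∀ x σ → x ∷ σ ↭ τ → H x σ ≈ 0#) → pickSum H τ ≈ 0#
    pickSum-0 []      eq = refl
    pickSum-0 (x ∷ τ) eq = trans (+-cong (eq x τ Perm.refl)
      (pickSum-0 τ λ y σ y∷σ↭τ → eq y (x ∷ σ) (Perm.trans (Perm.swap y x Perm.refl) (Perm.prep x y∷σ↭τ))))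
      (+-identityˡ 0#)

    pickSum-+ : ∀ {H K : X → List X → Carrier} τ →
                pickSum (λ x σ → H x σ + K x σ) τ ≈ pickSum H τ + pickSum K τ
    pickSum-+ []      = sym (+-identityˡ 0#)
    pickSum-+ {H} {K} (x ∷ τ) = trans (+-congˡ (pickSum-+ τ))
      (solve 4 (λ a b c d → (a :+ b) :+ (c :+ d) := (a :+ c) :+ (b :+ d)) refl (H x τ) (K x τ) _ _)

    pickSum-*ˡ : ∀ {H : X → List X → Carrier} k τ → pickSum (λ x σ → k * H x σ) τ ≈ k * pickSum H τ
    pickSum-*ˡ k []      = sym (zeroʳ k)
    pickSum-*ˡ k (x ∷ τ) = trans (+-congˡ (pickSum-*ˡ k τ)) (sym (distribˡ k _ _))

    -- Both sides run over the ordered pairs of distinct positions.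
    pickSum-swap : ∀ (H : X → X → List X → Carrier) τ →
      pickSum (λ x σ → pickSum (λ y → H x y) σ) τ ≈ pickSum (λ x σ → pickSum (λ y → H y x) σ) τ
    pickSum-swap H []      = refl
    pickSum-swap H (x ∷ τ) = begin
      pickSum (H x) τ + pickSum (λ y σ → H y x σ + pickSum (λ z ρ → H y z (x ∷ ρ)) σ) τ
        ≈⟨ +-congˡ (pickSum-+ τ) ⟩
      pickSum (H x) τ + (pickSum (λ y → H y x) τ + pickSum (λ y σ → pickSum (λ z ρ → H y z (x ∷ ρ)) σ) τ)
        ≈⟨ +-congˡ (+-congˡ (pickSum-swap (λ y z ρ → H y z (x ∷ ρ)) τ)) ⟩
      pickSum (H x) τ + (pickSum (λ y → H y x) τ + pickSum (λ y σ → pickSum (λ z ρ → H z y (x ∷ ρ)) σ) τ)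
        ≈⟨ solve 3 (λ a b c → a :+ (b :+ c) := b :+ (a :+ c)) refl _ _ _ ⟩
      pickSum (λ y → H y x) τ + (pickSum (H x) τ + pickSum (λ y σ → pickSum (λ z ρ → H z y (x ∷ ρ)) σ) τ)
        ≈⟨ +-congˡ (pickSum-+ τ) ⟨
      pickSum (λ y → H y x) τ + pickSum (λ y σ → H x y σ + pickSum (λ z ρ → H z y (x ∷ ρ)) σ) τ ∎

    pickSum-symmetric : ∀ {H : X → List X → Carrier} → (∀ x → Symmetric (H x)) → Symmetric (pickSum H)
    pickSum-symmetric H-sym Perm.refl        = refl
    pickSum-symmetric H-sym (Perm.prep x p)  =
      +-cong (H-sym x p) (pickSum-symmetric (λ y q → H-sym y (Perm.prep x q)) p)
    pickSum-symmetric {H} H-sym {_ ∷ _ ∷ σ} {_ ∷ _ ∷ τ} (Perm.swap x y p) = begin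
      H x (y ∷ σ) + (H y (x ∷ σ) + pickSum (λ z ρ → H z (x ∷ y ∷ ρ)) σ)
        ≈⟨ solve 3 (λ a b c → a :+ (b :+ c) := b :+ (a :+ c)) refl _ _ _ ⟩
      H y (x ∷ σ) + (H x (y ∷ σ) + pickSum (λ z ρ → H z (x ∷ y ∷ ρ)) σ)
        ≈⟨ +-cong (H-sym y (Perm.prep x p)) (+-cong (H-sym x (Perm.prep y p))
             (trans (pickSum-symmetric (λ z q → H-sym z (Perm.prep x (Perm.prep y q))) p)
                    (pickSum-cong τ λ z ρ _ → H-sym z (Perm.swap x y Perm.refl)))) ⟩
      H y (x ∷ τ) + (H x (y ∷ τ) + pickSum (λ z ρ → H z (y ∷ x ∷ ρ)) τ) ∎
    pickSum-symmetric H-sym (Perm.trans p q) = trans (pickSum-symmetric H-sym p) (pickSum-symmetric H-sym q)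

  -- A new element of kind v either forms a block of its own or joins one of the blocks of τ.
  insert : Variable → (Monomial → Carrier) → Monomial → Carrier
  insert v Ψ τ = Ψ (unit v ∷ τ) + pickSum (λ b σ → Ψ (b ⊕ v ∷ σ)) τ

  insert-symmetric : ∀ v {Ψ} → Symmetric Ψ → Symmetric (insert v Ψ)
  insert-symmetric v Ψ-sym p = +-cong (Ψ-sym (Perm.prep (unit v) p))
    (pickSum-symmetric (λ b q → Ψ-sym (Perm.prep (b ⊕ v) q)) p)

  insert-cong : ∀ v {d Φ Ψ} → (∀ τ → Partitions (d ⊕ v) τ → Φ τ ≈ Ψ τ) →
                ∀ τ → Partitions d τ → insert v Φ τ ≈ insert v Ψ τ
  insert-cong v eq τ p = +-cong (eq _ (partitions-unit v p))
    (pickSum-cong τ λ b σ b∷σ↭τ → eq _ (partitions-⊕ v (partitions-↭ (Perm.↭-sym b∷σ↭τ) p)))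

  insert-+ : ∀ v {Φ Ψ} τ → insert v (λ τ → Φ τ + Ψ τ) τ ≈ insert v Φ τ + insert v Ψ τ
  insert-+ v τ = trans (+-congˡ (pickSum-+ τ))
    (solve 4 (λ a b c d → (a :+ b) :+ (c :+ d) := (a :+ c) :+ (b :+ d)) refl _ _ _ _)

  insert-*ˡ : ∀ v k {Φ} τ → insert v (λ τ → k * Φ τ) τ ≈ k * insert v Φ τ
  insert-*ˡ v k τ = trans (+-congˡ (pickSum-*ˡ k τ)) (sym (distribˡ k _ _))

  -- Both sides run over the placements of two new elements: in two new blocks, together in one new
  -- block, one alone and the other in an old block (`old`), both in the same old block, or in two
  -- different old blocks (`twice`). Symmetry of Ψ absorbs the order in which the blocks get listed.
  insert-comm : ∀ v w {Ψ} → Symmetric Ψ → ∀ τ → insert v (insert w Ψ) τ ≈ insert w (insert v Ψ) τ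
  insert-comm v w {Ψ} Ψ-sym τ = begin
    insert v (insert w Ψ) τ
      ≈⟨ expand v w ⟩
    (Ψ (unit w ∷ unit v ∷ τ) + (Ψ (unit v ⊕ w ∷ τ) + old v w)) + (old w v + (pickSum (λ b σ → Ψ (b ⊕ v ⊕ w ∷ σ)) τ + twice v w))
      ≈⟨ +-cong (+-cong (Ψ-sym (Perm.swap _ _ Perm.refl)) (+-congʳ (reflexive (≡.cong (λ b → Ψ (b ∷ τ)) (⊕-comm (0 , 0) v w)))))
           (+-congˡ (+-cong (pickSum-cong τ λ b σ _ → reflexive (≡.cong (λ b → Ψ (b ∷ σ)) (⊕-comm b v w))) twice-comm)) ⟩
    (Ψ (unit v ∷ unit w ∷ τ) + (Ψ (unit w ⊕ v ∷ τ) + old v w)) + (old w v + (pickSum (λ b σ → Ψ (b ⊕ w ⊕ v ∷ σ)) τ + twice w v))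
      ≈⟨ solve 6 (λ a b c d e f → (a :+ (b :+ c)) :+ (d :+ (e :+ f)) := (a :+ (b :+ d)) :+ (c :+ (e :+ f))) refl _ _ _ _ _ _ ⟩
    (Ψ (unit v ∷ unit w ∷ τ) + (Ψ (unit w ⊕ v ∷ τ) + old w v)) + (old v w + (pickSum (λ b σ → Ψ (b ⊕ w ⊕ v ∷ σ)) τ + twice w v))
      ≈⟨ expand w v ⟨
    insert w (insert v Ψ) τ ∎
    where
    old twice : Variable → Variable → Carrier
    old v w = pickSum (λ b σ → Ψ (b ⊕ w ∷ unit v ∷ σ)) τ
    twice v w = pickSum (λ b σ → pickSum (λ b′ ρ → Ψ (b′ ⊕ w ∷ b ⊕ v ∷ ρ)) σ) τ
    twice-comm : twice v w ≈ twice w v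
    twice-comm = trans (pickSum-swap (λ b b′ ρ → Ψ (b′ ⊕ w ∷ b ⊕ v ∷ ρ)) τ)
      (pickSum-cong τ λ b σ _ → pickSum-cong σ λ b′ ρ _ → Ψ-sym (Perm.swap _ _ Perm.refl))
    expand : ∀ v w → insert v (insert w Ψ) τ ≈
      (Ψ (unit w ∷ unit v ∷ τ) + (Ψ (unit v ⊕ w ∷ τ) + old v w)) + (old w v + (pickSum (λ b σ → Ψ (b ⊕ v ⊕ w ∷ σ)) τ + twice v w))
    expand v w = +-congˡ (trans (pickSum-+ τ)
      (+-cong (pickSum-cong τ λ b σ _ → Ψ-sym (Perm.swap _ _ Perm.refl)) (pickSum-+ τ)))

  -- The sum of Φ over the set partitions of m small and j large elements,
  -- each reduced to its list of block types.
  partitionSum : ℕ → ℕ → (Monomial → Carrier) → Carrier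
  partitionSum zero    zero    Φ = Φ []
  partitionSum zero    (suc j) Φ = partitionSum zero j (insert 𝕪 Φ)
  partitionSum (suc m) j       Φ = partitionSum m j (insert 𝕩 Φ)

  partitionSum-cong : ∀ m j {Φ Ψ} → (∀ τ → Partitions (m , j) τ → Φ τ ≈ Ψ τ) →
                      partitionSum m j Φ ≈ partitionSum m j Ψ
  partitionSum-cong zero    zero    eq = eq [] ([] , ≡.refl)
  partitionSum-cong zero    (suc j) eq = partitionSum-cong zero j (insert-cong 𝕪 eq)
  partitionSum-cong (suc m) j       eq = partitionSum-cong m j (insert-cong 𝕩 eq)

  partitionSum-+ : ∀ m j {Φ Ψ} → partitionSum m j (λ τ → Φ τ + Ψ τ) ≈ partitionSum m j Φ + partitionSum m j Ψ
  partitionSum-+ zero    zero    = refl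
  partitionSum-+ zero    (suc j) {Φ} {Ψ} = trans (partitionSum-cong zero j λ τ _ → insert-+ 𝕪 {Φ} {Ψ} τ) (partitionSum-+ zero j)
  partitionSum-+ (suc m) j       {Φ} {Ψ} = trans (partitionSum-cong m j λ τ _ → insert-+ 𝕩 {Φ} {Ψ} τ) (partitionSum-+ m j)

  partitionSum-*ˡ : ∀ m j k {Φ} → partitionSum m j (λ τ → k * Φ τ) ≈ k * partitionSum m j Φ
  partitionSum-*ˡ zero    zero    k = refl
  partitionSum-*ˡ zero    (suc j) k {Φ} = trans (partitionSum-cong zero j λ τ _ → insert-*ˡ 𝕪 k {Φ} τ) (partitionSum-*ˡ zero j k)
  partitionSum-*ˡ (suc m) j       k {Φ} = trans (partitionSum-cong m j λ τ _ → insert-*ˡ 𝕩 k {Φ} τ) (partitionSum-*ˡ m j k)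

  partitionSum-0 : ∀ m j {Φ} → (∀ τ → Partitions (m , j) τ → Φ τ ≈ 0#) → partitionSum m j Φ ≈ 0#
  partitionSum-0 m j {Φ} eq = trans (partitionSum-cong m j λ τ p → trans (eq τ p) (sym (zeroˡ 0#)))
    (trans (partitionSum-*ˡ m j 0#) (zeroˡ (partitionSum m j (λ _ → 0#))))

  -- By definition a large element is removed only when no small one is left; commuting insertions
  -- permits it at any stage.
  partitionSum-sucʳ : ∀ m j {Φ} → Symmetric Φ → partitionSum m (suc j) Φ ≈ partitionSum m j (insert 𝕪 Φ)
  partitionSum-sucʳ zero    j Φ-sym = refl
  partitionSum-sucʳ (suc m) j Φ-sym = trans (partitionSum-sucʳ m j (insert-symmetric 𝕩 Φ-sym))
    (partitionSum-cong m j λ τ _ → insert-comm 𝕪 𝕩 Φ-sym τ)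

  whenLarge : Block → Carrier → Carrier
  whenLarge (0 , 1) x = x
  whenLarge _       x = 0#

  whenLarge-split : ∀ b → (0 , 1) ≡ b ⊎ (∀ x → whenLarge b x ≈ 0#)
  whenLarge-split (0 , 0)             = inj₂ λ _ → refl
  whenLarge-split (0 , 1)             = inj₁ ≡.refl
  whenLarge-split (0 , suc (suc _))   = inj₂ λ _ → refl
  whenLarge-split (suc _ , _)         = inj₂ λ _ → refl

  whenLarge-⊕ : ∀ b v x → 1 ℕ.≤ size b → whenLarge (b ⊕ v) x ≈ 0#
  whenLarge-⊕ (s , l)           𝕩 x _ = refl
  whenLarge-⊕ (zero , suc l)    𝕪 x _ = refl
  whenLarge-⊕ (suc s , l)       𝕪 x _ = refl

  whenLarge-* : ∀ b x → whenLarge b x ≈ whenLarge b 1# * x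
  whenLarge-* b x with whenLarge-split b
  ... | inj₁ ≡.refl = sym (*-identityˡ x)
  ... | inj₂ p      = trans (p x) (sym (trans (*-congʳ (p 1#)) (zeroˡ x)))

  mark : (Monomial → Carrier) → Monomial → Carrier
  mark Ψ = pickSum (λ b σ → whenLarge b (Ψ σ))

  -- The canonical commutation relation between annihilation (mark) and
  -- creation (insert 𝕪) of a large singleton.
  insert-mark : ∀ v {Ψ d} τ → Partitions d τ →
                insert v (mark Ψ) τ ≈ whenLarge (unit v) (Ψ τ) + mark (insert v Ψ) τ
  insert-mark v {Ψ} τ p = begin
    (whenLarge (unit v) (Ψ τ) + new) + pickSum (λ b σ → whenLarge (b ⊕ v) (Ψ σ) + pickSum (λ b′ ρ → whenLarge b′ (Ψ (b ⊕ v ∷ ρ))) σ) τ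
      ≈⟨ +-assoc _ _ _ ⟩
    whenLarge (unit v) (Ψ τ) + (new + pickSum (λ b σ → whenLarge (b ⊕ v) (Ψ σ) + pickSum (λ b′ ρ → whenLarge b′ (Ψ (b ⊕ v ∷ ρ))) σ) τ)
      -- The block that the new element joins is nonempty, so the result has at least two elements
      -- and cannot be a large singleton.
      ≈⟨ +-congˡ (+-congˡ (pickSum-cong τ λ b σ b∷σ↭τ → trans
           (+-congʳ (whenLarge-⊕ b v (Ψ σ) (All.head (nonempty (partitions-↭ (Perm.↭-sym b∷σ↭τ) p))))) (+-identityˡ _))) ⟩
    whenLarge (unit v) (Ψ τ) + (new + pickSum (λ b σ → pickSum (λ b′ ρ → whenLarge b′ (Ψ (b ⊕ v ∷ ρ))) σ) τ)
      ≈⟨ +-congˡ (+-congˡ (pickSum-swap (λ b b′ ρ → whenLarge b′ (Ψ (b ⊕ v ∷ ρ))) τ)) ⟩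
    whenLarge (unit v) (Ψ τ) + (new + pickSum (λ b σ → pickSum (λ b′ ρ → whenLarge b (Ψ (b′ ⊕ v ∷ ρ))) σ) τ)
      ≈⟨ +-congˡ (pickSum-+ τ) ⟨
    whenLarge (unit v) (Ψ τ) + pickSum (λ b σ → whenLarge b (Ψ (unit v ∷ σ)) + pickSum (λ b′ ρ → whenLarge b (Ψ (b′ ⊕ v ∷ ρ))) σ) τ
      ≈⟨ +-congˡ (pickSum-cong τ λ b σ _ → collect b σ) ⟩
    whenLarge (unit v) (Ψ τ) + pickSum (λ b σ → whenLarge b (insert v Ψ σ)) τ ∎
    where
    new = pickSum (λ b σ → whenLarge b (Ψ (unit v ∷ σ))) τ
    collect : ∀ b σ → whenLarge b (Ψ (unit v ∷ σ)) + pickSum (λ b′ ρ → whenLarge b (Ψ (b′ ⊕ v ∷ ρ))) σ ≈ whenLarge b (insert v Ψ σ)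
    collect b σ = begin
      whenLarge b (Ψ (unit v ∷ σ)) + pickSum (λ b′ ρ → whenLarge b (Ψ (b′ ⊕ v ∷ ρ))) σ
        ≈⟨ +-cong (whenLarge-* b _) (trans (pickSum-cong σ λ b′ ρ _ → whenLarge-* b _) (pickSum-*ˡ (whenLarge b 1#) σ)) ⟩
      whenLarge b 1# * Ψ (unit v ∷ σ) + whenLarge b 1# * pickSum (λ b′ ρ → Ψ (b′ ⊕ v ∷ ρ)) σ
        ≈⟨ distribˡ _ _ _ ⟨
      whenLarge b 1# * insert v Ψ σ  ≈⟨ whenLarge-* b _ ⟨
      whenLarge b (insert v Ψ σ)     ∎

  partitionSum-mark-zero : ∀ m {Ψ} → partitionSum m 0 (mark Ψ) ≈ 0#
  partitionSum-mark-zero zero    = refl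
  partitionSum-mark-zero (suc m) {Ψ} = trans
    (partitionSum-cong m 0 λ τ p → trans (insert-mark 𝕩 {Ψ} τ p) (+-identityˡ _)) (partitionSum-mark-zero m)

  -- A partition with a marked large singleton is a choice of one of the `suc j` large elements
  -- together with a partition of the rest. In the proof, each large insertion that `mark` passes
  -- contributes one copy, while small ones contribute none.
  partitionSum-mark-suc : ∀ m j {Ψ} → partitionSum m (suc j) (mark Ψ) ≈ (suc j · 1#) * partitionSum m j Ψ
  partitionSum-mark-suc (suc m) j {Ψ} = trans
    (partitionSum-cong m (suc j) λ τ p → trans (insert-mark 𝕩 {Ψ} τ p) (+-identityˡ _)) (partitionSum-mark-suc m j)
  partitionSum-mark-suc zero j {Ψ} = begin
    partitionSum 0 j (insert 𝕪 (mark Ψ))                              ≈⟨ partitionSum-cong 0 j (insert-mark 𝕪) ⟩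
    partitionSum 0 j (λ τ → Ψ τ + mark (insert 𝕪 Ψ) τ)                ≈⟨ partitionSum-+ 0 j ⟩
    partitionSum 0 j Ψ + partitionSum 0 j (mark (insert 𝕪 Ψ))         ≈⟨ +-cong (sym (*-identityˡ _)) (rest j) ⟩
    1# * partitionSum 0 j Ψ + (j · 1#) * partitionSum 0 j Ψ           ≈⟨ distribʳ _ _ _ ⟨
    (suc j · 1#) * partitionSum 0 j Ψ                                 ∎
    where
    rest : ∀ j → partitionSum 0 j (mark (insert 𝕪 Ψ)) ≈ (j · 1#) * partitionSum 0 j Ψ
    rest zero    = sym (zeroˡ _)
    rest (suc j) = partitionSum-mark-suc zero j

  -- Fixing the number of blocks inside the functional lets one operator `partitionSum` serve every
  -- k.
  weight : (Block → Carrier) → ℕ → Monomial → Carrier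
  weight g zero    []      = 1#
  weight g zero    (_ ∷ _) = 0#
  weight g (suc k) []      = 0#
  weight g (suc k) (b ∷ τ) = g b * weight g k τ

  -- Indexed so that it differentiates weight g (suc k), not weight g k.
  derivation : (Block → Carrier) → (Block → Carrier) → ℕ → Monomial → Carrier
  derivation h g k = pickSum (λ b σ → h b * weight g k σ)

  weight-symmetric : ∀ g k → Symmetric (weight g k)
  weight-symmetric g k       Perm.refl       = refl
  weight-symmetric g zero    (Perm.prep x p) = refl
  weight-symmetric g (suc k) (Perm.prep x p) = *-congˡ (weight-symmetric g k p)
  weight-symmetric g zero    (Perm.swap x y p) = refl
  weight-symmetric g (suc zero)    (Perm.swap x y p) = trans (zeroʳ _) (sym (zeroʳ _))
  weight-symmetric g (suc (suc k)) (Perm.swap x y p) = trans (*-congˡ (*-congˡ (weight-symmetric g k p)))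
    (solve 3 (λ a b c → a :* (b :* c) := b :* (a :* c)) refl _ _ _)
  weight-symmetric g k (Perm.trans p q) = trans (weight-symmetric g k p) (weight-symmetric g k q)

  weight-length : ∀ g k τ → length τ ≢ k → weight g k τ ≈ 0#
  weight-length g zero    []      len = ⊥-elim (len ≡.refl)
  weight-length g zero    (_ ∷ _) len = refl
  weight-length g (suc k) []      len = refl
  weight-length g (suc k) (b ∷ τ) len =
    trans (*-congˡ (weight-length g k τ (λ eq → len (≡.cong suc eq)))) (zeroʳ _)

  weight-zero : ∀ g k τ → Any (λ b → g b ≈ 0#) τ → weight g k τ ≈ 0#
  weight-zero g zero    (_ ∷ _) _         = refl
  weight-zero g (suc k) (b ∷ τ) (here p)  = trans (*-congʳ p) (zeroˡ _)
  weight-zero g (suc k) (b ∷ τ) (there p) = trans (*-congˡ (weight-zero g k τ p)) (zeroʳ _)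

  derivation-length : ∀ h g k τ → length τ ≢ suc k → derivation h g k τ ≈ 0#
  derivation-length h g k τ len = pickSum-0 τ λ b σ p →
    trans (*-congˡ (weight-length g k σ (λ eq → len (≡.trans (≡.sym (↭-length p)) (≡.cong suc eq))))) (zeroʳ _)

  derivation-zero : ∀ h g k τ → Any (λ b → h b ≈ 0# × g b ≈ 0#) τ → derivation h g k τ ≈ 0#
  derivation-zero h g k τ z = pickSum-0 τ λ b σ p → lemma b σ (Any-resp-↭ (Perm.↭-sym p) z)
    where
    lemma : ∀ b σ → Any (λ b → h b ≈ 0# × g b ≈ 0#) (b ∷ σ) → h b * weight g k σ ≈ 0#
    lemma b σ (here (p , _)) = trans (*-congʳ p) (zeroˡ _)
    lemma b σ (there p)      = trans (*-congˡ (weight-zero g k σ (Any.map proj₂ p))) (zeroʳ _)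

  -- Recurrences for weighted sums over set partitions

  module Recurrence (g : Block → Carrier) (g-large : g (0 , 1) ≈ 0#) where

    -- The formal partial derivatives of g, except that the weight of a large
    -- singleton is the constant 0.
    shift : Variable → Block → Carrier
    shift v (0 , 1) = 0#
    shift v b       = g (b ⊕ v)

    -- For the truncated partial derivatives of F this is I (m, j + 1): one block more than there
    -- are large elements.
    P : ℕ → ℕ → Carrier
    P m j = partitionSum m j (weight g (suc j))

    ∂P : Variable → ℕ → ℕ → Carrier
    ∂P v m j = partitionSum m j (derivation (shift v) g j)

    markedP : ℕ → ℕ → Carrier
    markedP m j = partitionSum m j (mark (weight g j))

    -- The two weights differ only at a large singleton, which ceases to be forbidden when the new
    -- element joins it. `whenLarge` records this exception.
    shift-split : ∀ v b x → g (b ⊕ v) * x ≈ shift v b * x + g ((0 , 1) ⊕ v) * whenLarge b x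
    shift-split v (0 , 0)           x = solve 3 (λ a b c → a :* b := a :* b :+ c :* con (+ 0)) refl _ _ _
    shift-split v (0 , 1)           x = solve 2 (λ a b → a :* b := con (+ 0) :* b :+ a :* b) refl _ _
    shift-split v (0 , suc (suc _)) x = solve 3 (λ a b c → a :* b := a :* b :+ c :* con (+ 0)) refl _ _ _
    shift-split v (suc _ , _)       x = solve 3 (λ a b c → a :* b := a :* b :+ c :* con (+ 0)) refl _ _ _

    insert-weight : ∀ v k τ → insert v (weight g (suc k)) τ ≈
      g (unit v) * weight g k τ + (derivation (shift v) g k τ + g ((0 , 1) ⊕ v) * mark (weight g k) τ)
    insert-weight v k τ = +-congˡ (trans (pickSum-cong τ λ b σ _ → shift-split v b (weight g k σ))
      (trans (pickSum-+ τ) (+-congˡ (pickSum-*ˡ (g ((0 , 1) ⊕ v)) τ))))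

    partitionSum-insert-weight : ∀ v m k → partitionSum m k (insert v (weight g (suc k))) ≈
      g (unit v) * partitionSum m k (weight g k) + (∂P v m k + g ((0 , 1) ⊕ v) * markedP m k)
    partitionSum-insert-weight v m k = begin
      partitionSum m k (insert v (weight g (suc k)))
        ≈⟨ partitionSum-cong m k (λ τ _ → insert-weight v k τ) ⟩
      partitionSum m k (λ τ → g (unit v) * weight g k τ + (derivation (shift v) g k τ + κ * mark (weight g k) τ))
        ≈⟨ partitionSum-+ m k ⟩
      partitionSum m k (λ τ → g (unit v) * weight g k τ) + partitionSum m k (λ τ → derivation (shift v) g k τ + κ * mark (weight g k) τ)
        ≈⟨ +-cong (partitionSum-*ˡ m k (g (unit v))) (trans (partitionSum-+ m k) (+-congˡ (partitionSum-*ˡ m k κ))) ⟩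
      g (unit v) * partitionSum m k (weight g k) + (∂P v m k + κ * markedP m k) ∎
      where κ = g ((0 , 1) ⊕ v)

    -- Here blocks and large elements are equally many, as happens once a new small singleton has
    -- been split off. Removing a large element lowers both sides to known sums; its being alone
    -- contributes g (0 , 1), which is 0.
    partitionSum-weight-suc : ∀ m i → partitionSum m (suc i) (weight g (suc i)) ≈ ∂P 𝕪 m i + g (0 , 2) * markedP m i
    partitionSum-weight-suc m i = trans (partitionSum-sucʳ m i (weight-symmetric g (suc i)))
      (trans (partitionSum-insert-weight 𝕪 m i) (trans (+-congʳ (trans (*-congʳ g-large) (zeroˡ _))) (+-identityˡ _)))

    partitionSum-weight-zero : ∀ m → partitionSum (suc m) 0 (weight g 0) ≈ 0#
    partitionSum-weight-zero m = partitionSum-0 (suc m) 0 {weight g 0} λ { (_ ∷ _) _ → refl ; [] (_ , ()) }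

    markedP-zero : ∀ m → markedP m 0 ≈ 0#
    markedP-zero m = partitionSum-mark-zero m

    markedP-suc : ∀ m i → markedP m (suc i) ≈ (suc i · 1#) * P m i
    markedP-suc m i = partitionSum-mark-suc m i

    P-vanishes : ∀ m j → m ℕ.+ m ℕ.≤ suc j → P m j ≈ 0#
    P-vanishes m j m+m≤ = partitionSum-0 m j λ τ p → lemma τ p
      where
      lemma : ∀ τ → Partitions (m , j) τ → weight g (suc j) τ ≈ 0#
      lemma τ p with length τ ℕ.≟ suc j
      ... | no len  = weight-length g (suc j) τ len
      ... | yes len = weight-zero g (suc j) τ (Any.map (λ { ≡.refl → g-large }) (few-blocks p len m+m≤))

    -- The large singleton found by `few-blocks` kills every term: its factor is 0 whether it is the
    -- differentiated one or not.
    ∂P-vanishes : ∀ v m j → m ℕ.+ m ℕ.≤ suc j → ∂P v m j ≈ 0#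
    ∂P-vanishes v m j m+m≤ = partitionSum-0 m j λ τ p → lemma τ p
      where
      lemma : ∀ τ → Partitions (m , j) τ → derivation (shift v) g j τ ≈ 0#
      lemma τ p with length τ ℕ.≟ suc j
      ... | no len  = derivation-length (shift v) g j τ len
      ... | yes len = derivation-zero (shift v) g j τ (Any.map (λ { ≡.refl → refl , g-large }) (few-blocks p len m+m≤))

-- Sums over families of subsets

module _ {m : ℕ} where

  disjoint-sym : ∀ {B C : Subset m} → Disjoint B C → Disjoint C B
  disjoint-sym {B} {C} d (i , i∈) = d (i , ≡.subst (i ∈_) (∩-comm C B) i∈)

  disjoint-irrefl : ∀ {B : Subset m} → Nonempty B → ¬ Disjoint B B
  disjoint-irrefl (i , i∈B) d = d (i , x∈p∩q⁺ (i∈B , i∈B))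

  allPairs-↭ : ∀ {σ τ : List (Subset m)} → σ ↭ τ → AllPairs Disjoint σ → AllPairs Disjoint τ
  allPairs-↭ p = SetoidPerm.AllPairs-resp-↭ (≡.setoid (Subset m))
    (λ {B} {C} → disjoint-sym {B} {C}) ((λ { ≡.refl d → d }) , (λ { ≡.refl d → d })) (↭⇒↭ₛ p)

  isSetPartition-↭ : ∀ {σ τ : List (Subset m)} → σ ↭ τ → IsSetPartition σ → IsSetPartition τ
  isSetPartition-↭ p (ne , dis , cover) =
    All-resp-↭ p ne , allPairs-↭ p dis , λ i → Any-resp-↭ p (cover i)

module _ {m : ℕ} where

  disjoint-out : ∀ {t} {B C : Subset m} → Disjoint B C → Disjoint (outside Vec.∷ B) (t Vec.∷ C)
  disjoint-out d (zero , ())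
  disjoint-out d (suc i , Vec.there i∈) = d (i , i∈)

  disjoint-in-out : ∀ {B C : Subset m} → Disjoint B C → Disjoint (inside Vec.∷ B) (outside Vec.∷ C)
  disjoint-in-out d (zero , ())
  disjoint-in-out d (suc i , Vec.there i∈) = d (i , i∈)

  disjoint-tail : ∀ {s t} {B C : Subset m} → Disjoint (s Vec.∷ B) (t Vec.∷ C) → Disjoint B C
  disjoint-tail d (i , i∈) = d (suc i , Vec.there i∈)

  nonempty-out : ∀ {B : Subset m} → Nonempty B → Nonempty (outside Vec.∷ B)
  nonempty-out (i , i∈) = suc i , Vec.there i∈

  nonempty-out⁻ : ∀ {B : Subset m} → Nonempty (outside Vec.∷ B) → Nonempty B
  nonempty-out⁻ (suc i , Vec.there i∈) = i , i∈

  -- What remains of a partition when its first element is deleted, B being the rest of that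
  -- element's block. Since B may be empty, the cases of a singleton and of a larger block share one
  -- equivalence with `extend`.
  AlmostPartition : Subset m → List (Subset m) → Set
  AlmostPartition B σ =
    All Nonempty σ × All (Disjoint B) σ × AllPairs Disjoint σ × (∀ i → Any (i ∈_) (B ∷ σ))

  extend : Subset m → List (Subset m) → List (Subset (suc m))
  extend B σ = (inside Vec.∷ B) ∷ map (outside Vec.∷_) σ

  almost⇒extend : ∀ {B σ} → AlmostPartition B σ → IsSetPartition (extend B σ)
  almost⇒extend {B} {σ} (ne , disB , dis , cover) =
    (zero , Vec.here) ∷ All.map⁺ (All.map nonempty-out ne) ,
    All.map⁺ (All.map (λ {C} → disjoint-in-out {B} {C}) disB) ∷ AllPairs.map⁺ (AllPairs.map (λ {C} {D} → disjoint-out {outside} {C} {D}) dis) ,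
    λ { zero → here Vec.here ; (suc i) → cover′ i (cover i) }
    where
    cover′ : ∀ i → Any (i ∈_) (B ∷ σ) → Any (suc i ∈_) (extend B σ)
    cover′ i (here p)  = here (Vec.there p)
    cover′ i (there p) = there (Any.map⁺ (Any.map Vec.there p))

  extend⇒almost : ∀ {B σ} → IsSetPartition (extend B σ) → AlmostPartition B σ
  extend⇒almost {B} {σ} (_ ∷ ne , disB ∷ dis , cover) =
    All.map nonempty-out⁻ (All.map⁻ ne) ,
    All.map (λ {C} → disjoint-tail {inside} {outside} {B} {C}) (All.map⁻ disB) ,
    AllPairs.map (λ {C} {D} → disjoint-tail {outside} {outside} {C} {D}) (AllPairs.map⁻ dis) ,
    λ i → cover′ i (cover (suc i))
    where
    cover′ : ∀ i → Any (suc i ∈_) (extend B σ) → Any (i ∈_) (B ∷ σ)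
    cover′ i (here p)  = here (drop-there p)
    cover′ i (there p) = there (Any.map drop-there (Any.map⁻ p))

  almost⇒partition-∷ : ∀ {B σ} → Nonempty B → AlmostPartition B σ → IsSetPartition (B ∷ σ)
  almost⇒partition-∷ neB (ne , disB , dis , cover) = neB ∷ ne , disB ∷ dis , cover

  partition-∷⇒almost : ∀ {B σ} → IsSetPartition (B ∷ σ) → AlmostPartition B σ
  partition-∷⇒almost (_ ∷ ne , disB ∷ dis , cover) = ne , disB , dis , cover

  almost⇒partition : ∀ {B σ} → Empty B → AlmostPartition B σ → IsSetPartition σ
  almost⇒partition {B} {σ} B-empty (ne , _ , dis , cover) = ne , dis , λ i → cover′ i (cover i)
    where
    cover′ : ∀ i → Any (i ∈_) (B ∷ σ) → Any (i ∈_) σ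
    cover′ i (here p)  = ⊥-elim (B-empty (i , p))
    cover′ i (there p) = p

  partition⇒almost : ∀ {B σ} → Empty B → IsSetPartition σ → AlmostPartition B σ
  partition⇒almost {B} B-empty (ne , dis , cover) =
    ne , All.universal (λ C (i , i∈) → B-empty (i , p∩q⊆p B C i∈)) _ , dis , λ i → there (cover i)

  -- Two blocks containing the first element would meet in it. With the next lemma, exactly one
  -- block contains it.
  no-two-extended : ∀ {σ B C τ} →
    ¬ IsSetPartition (map (outside Vec.∷_) σ ++ map (inside Vec.∷_) (B ∷ C ∷ τ))
  no-two-extended {σ} {B} {C} {τ} p with isSetPartition-↭ (++-comm (map (outside Vec.∷_) σ) (map (inside Vec.∷_) (B ∷ C ∷ τ))) p
  ... | _ , (d ∷ _) ∷ _ , _ = d (zero {m} , Vec.here)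

  none-extended : ∀ {σ} → ¬ IsSetPartition (map {B = Subset (suc m)} (outside Vec.∷_) σ)
  none-extended {σ} (_ , _ , cover) with Any.satisfied (Any.map⁻ {f = outside Vec.∷_} {xs = σ} (cover zero))
  ... | _ , ()

module ListSums {c ℓ} (A : CommutativeRing c ℓ) where

  open CommutativeRing A hiding (zero)
  open IntegerSolver A
  open Functionals A
  open import Relation.Binary.Reasoning.Setoid setoid

  when : ∀ {P : Set} → Dec P → Carrier → Carrier
  when (yes _) x = x
  when (no _)  x = 0#

  when-yes : ∀ {P : Set} (P? : Dec P) {x} → P → when P? x ≈ x
  when-yes (yes _) p = refl
  when-yes (no ¬p) p = ⊥-elim (¬p p)

  when-no : ∀ {P : Set} (P? : Dec P) {x} → ¬ P → when P? x ≈ 0#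
  when-no (yes p) ¬p = ⊥-elim (¬p p)
  when-no (no _)  ¬p = refl

  when-⇔ : ∀ {P Q : Set} (P? : Dec P) (Q? : Dec Q) {x y} → (P → Q) → (Q → P) → x ≈ y → when P? x ≈ when Q? y
  when-⇔ (yes p) Q? to from x≈y = trans x≈y (sym (when-yes Q? (to p)))
  when-⇔ (no ¬p) Q? to from x≈y = sym (when-no Q? (λ q → ¬p (from q)))

  when-cong : ∀ {P : Set} (P? : Dec P) {x y} → (P → x ≈ y) → when P? x ≈ when P? y
  when-cong (yes p) eq = eq p
  when-cong (no _)  eq = refl

  when-0 : ∀ {P : Set} (P? : Dec P) {x} → x ≈ 0# → when P? x ≈ 0#
  when-0 (yes _) x≈0 = x≈0
  when-0 (no _)  _   = refl

  when-+ : ∀ {P : Set} (P? : Dec P) {x y} → when P? (x + y) ≈ when P? x + when P? y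
  when-+ (yes _) = refl
  when-+ (no _)  = sym (+-identityˡ 0#)

  ∑ : ∀ {X : Set} → (X → Carrier) → List X → Carrier
  ∑ f xs = foldr _+_ 0# (map f xs)

  ∑-cong : ∀ {X : Set} {f g : X → Carrier} xs → (∀ x → f x ≈ g x) → ∑ f xs ≈ ∑ g xs
  ∑-cong []       eq = refl
  ∑-cong (x ∷ xs) eq = +-cong (eq x) (∑-cong xs eq)

  ∑-0 : ∀ {X : Set} {f : X → Carrier} xs → (∀ x → f x ≈ 0#) → ∑ f xs ≈ 0#
  ∑-0 []       eq = refl
  ∑-0 (x ∷ xs) eq = trans (+-cong (eq x) (∑-0 xs eq)) (+-identityˡ 0#)

  ∑-+ : ∀ {X : Set} {f g : X → Carrier} xs → ∑ (λ x → f x + g x) xs ≈ ∑ f xs + ∑ g xs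
  ∑-+ []       = sym (+-identityˡ 0#)
  ∑-+ {_} {f} {g} (x ∷ xs) = trans (+-congˡ (∑-+ xs))
    (solve 4 (λ a b c d → (a :+ b) :+ (c :+ d) := (a :+ c) :+ (b :+ d)) refl (f x) (g x) _ _)

  ∑-++ : ∀ {X : Set} {f : X → Carrier} xs ys → ∑ f (xs ++ ys) ≈ ∑ f xs + ∑ f ys
  ∑-++ []       ys = sym (+-identityˡ _)
  ∑-++ (x ∷ xs) ys = trans (+-congˡ (∑-++ xs ys)) (sym (+-assoc _ _ _))

  ∑-swap : ∀ {X Y : Set} (f : X → Y → Carrier) xs ys → ∑ (λ x → ∑ (f x) ys) xs ≈ ∑ (λ y → ∑ (λ x → f x y) xs) ys
  ∑-swap f []       ys = sym (∑-0 ys λ _ → refl)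
  ∑-swap f (x ∷ xs) ys = trans (+-congˡ (∑-swap f xs ys)) (sym (∑-+ ys))

  ∑-map : ∀ {X Y : Set} (f : X → Carrier) (g : Y → X) ys → ∑ f (map g ys) ≈ ∑ (λ y → f (g y)) ys
  ∑-map f g ys = reflexive (≡.cong (foldr _+_ 0#) (≡.sym (map-∘ ys)))

  ∑-filter : ∀ {X : Set} {P : X → Set} (P? : ∀ x → Dec (P x)) (f : X → Carrier) xs →
             ∑ f (filter P? xs) ≈ ∑ (λ x → when (P? x) (f x)) xs
  ∑-filter P? f []       = refl
  ∑-filter P? f (x ∷ xs) with P? x
  ... | yes _ = +-congˡ (∑-filter P? f xs)
  ... | no _  = trans (∑-filter P? f xs) (sym (+-identityˡ _))

  ∑-sublists-∷ : ∀ {X : Set} (f : List X → Carrier) x xs →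
    ∑ f (sublists (x ∷ xs)) ≈ ∑ f (sublists xs) + ∑ (λ σ → f (x ∷ σ)) (sublists xs)
  ∑-sublists-∷ f x xs = trans (∑-++ (sublists xs) (map (x ∷_) (sublists xs)))
    (+-congˡ (∑-map f (x ∷_) (sublists xs)))

  module _ {X : Set} where

    ∑-sublists-++ : ∀ (f : List X → Carrier) xs ys →
      ∑ f (sublists (xs ++ ys)) ≈ ∑ (λ σ → ∑ (λ τ → f (σ ++ τ)) (sublists ys)) (sublists xs)
    ∑-sublists-++ f []       ys = sym (+-identityʳ _)
    ∑-sublists-++ f (x ∷ xs) ys = begin
      ∑ f (sublists (x ∷ xs ++ ys))
        ≈⟨ ∑-sublists-∷ f x (xs ++ ys) ⟩
      ∑ f (sublists (xs ++ ys)) + ∑ (λ σ → f (x ∷ σ)) (sublists (xs ++ ys))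
        ≈⟨ +-cong (∑-sublists-++ f xs ys) (∑-sublists-++ (λ σ → f (x ∷ σ)) xs ys) ⟩
      _ ≈⟨ ∑-sublists-∷ (λ σ → ∑ (λ τ → f (σ ++ τ)) (sublists ys)) x xs ⟨
      ∑ (λ σ → ∑ (λ τ → f (σ ++ τ)) (sublists ys)) (sublists (x ∷ xs)) ∎

    ∑-sublists-map : ∀ {Y : Set} (f : List Y → Carrier) (g : X → Y) xs →
      ∑ f (sublists (map g xs)) ≈ ∑ (λ σ → f (map g σ)) (sublists xs)
    ∑-sublists-map f g []       = refl
    ∑-sublists-map f g (x ∷ xs) = begin
      ∑ f (sublists (g x ∷ map g xs))
        ≈⟨ ∑-sublists-∷ f (g x) (map g xs) ⟩
      ∑ f (sublists (map g xs)) + ∑ (λ σ → f (g x ∷ σ)) (sublists (map g xs))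
        ≈⟨ +-cong (∑-sublists-map f g xs) (∑-sublists-map (λ σ → f (g x ∷ σ)) g xs) ⟩
      _ ≈⟨ ∑-sublists-∷ (λ σ → f (map g σ)) x xs ⟨
      ∑ (λ σ → f (map g σ)) (sublists (x ∷ xs)) ∎

    ∑-sublists-nil : ∀ (f : List X → Carrier) → (∀ x τ → f (x ∷ τ) ≈ 0#) → ∀ xs → ∑ f (sublists xs) ≈ f []
    ∑-sublists-nil f f-zero []       = +-identityʳ _
    ∑-sublists-nil f f-zero (x ∷ xs) = trans (∑-sublists-∷ f x xs)
      (trans (+-cong (∑-sublists-nil f f-zero xs) (∑-0 (sublists xs) (f-zero x))) (+-identityʳ _))

    ∑-sublists-singletons : ∀ (f : List X → Carrier) → f [] ≈ 0# → (∀ x y τ → f (x ∷ y ∷ τ) ≈ 0#) →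
      ∀ xs → ∑ f (sublists xs) ≈ ∑ (λ x → f (x ∷ [])) xs
    ∑-sublists-singletons f f[]≈0 f-zero []       = trans (+-identityʳ _) f[]≈0
    ∑-sublists-singletons f f[]≈0 f-zero (x ∷ xs) = begin
      ∑ f (sublists (x ∷ xs))                                      ≈⟨ ∑-sublists-∷ f x xs ⟩
      ∑ f (sublists xs) + ∑ (λ σ → f (x ∷ σ)) (sublists xs)        ≈⟨ +-comm _ _ ⟩
      ∑ (λ σ → f (x ∷ σ)) (sublists xs) + ∑ f (sublists xs)
        ≈⟨ +-cong (∑-sublists-nil (λ σ → f (x ∷ σ)) (f-zero x) xs) (∑-sublists-singletons f f[]≈0 f-zero xs) ⟩
      f (x ∷ []) + ∑ (λ y → f (y ∷ [])) xs                         ∎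

    -- Choosing an element and a sublist not containing it amounts to choosing
    -- a sublist and one of its elements.
    ∑-sublists-pick : ∀ (H : X → List X → Carrier) → (∀ x σ → x ∈ₗ σ → H x σ ≈ 0#) →
      ∀ xs → ∑ (λ x → ∑ (H x) (sublists xs)) xs ≈ ∑ (pickSum H) (sublists xs)
    ∑-sublists-pick H H-zero []       = sym (+-identityʳ 0#)
    ∑-sublists-pick H H-zero (x ∷ xs) = begin
      ∑ (H x) (sublists (x ∷ xs)) + ∑ (λ y → ∑ (H y) (sublists (x ∷ xs))) xs
        ≈⟨ +-cong (trans (∑-sublists-∷ (H x) x xs) (trans (+-congˡ (∑-0 (sublists xs) λ σ → H-zero x (x ∷ σ) (here ≡.refl))) (+-identityʳ _)))
             (trans (∑-cong xs λ y → ∑-sublists-∷ (H y) x xs) (∑-+ xs)) ⟩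
      ∑ (H x) (sublists xs) + (∑ (λ y → ∑ (H y) (sublists xs)) xs + ∑ (λ y → ∑ (λ σ → H y (x ∷ σ)) (sublists xs)) xs)
        ≈⟨ +-congˡ (+-cong (∑-sublists-pick H H-zero xs)
             (∑-sublists-pick (λ y σ → H y (x ∷ σ)) (λ y σ y∈σ → H-zero y (x ∷ σ) (there y∈σ)) xs)) ⟩
      ∑ (H x) (sublists xs) + (∑ (pickSum H) (sublists xs) + ∑ (pickSum (λ y σ → H y (x ∷ σ))) (sublists xs))
        ≈⟨ solve 3 (λ a b c → a :+ (b :+ c) := b :+ (a :+ c)) refl _ _ _ ⟩
      ∑ (pickSum H) (sublists xs) + (∑ (H x) (sublists xs) + ∑ (pickSum (λ y σ → H y (x ∷ σ))) (sublists xs))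
        ≈⟨ +-congˡ (∑-+ (sublists xs)) ⟨
      ∑ (pickSum H) (sublists xs) + ∑ (λ σ → H x σ + pickSum (λ y σ → H y (x ∷ σ)) σ) (sublists xs)
        ≈⟨ ∑-sublists-∷ (pickSum H) x xs ⟨
      ∑ (pickSum H) (sublists (x ∷ xs)) ∎

    pickSum-map : ∀ {Y : Set} (H : Y → List Y → Carrier) (f : X → Y) τ →
      pickSum H (map f τ) ≈ pickSum (λ x σ → H (f x) (map f σ)) τ
    pickSum-map H f []      = refl
    pickSum-map H f (x ∷ τ) = +-congˡ (pickSum-map (λ y σ → H y (f x ∷ σ)) f τ)

  ∑-subsets-empty : ∀ m (f : Subset m → Carrier) → (∀ B → Nonempty B → f B ≈ 0#) → ∑ f (subsets m) ≈ f ∅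
  ∑-subsets-empty zero    f f-zero = +-identityʳ _
  ∑-subsets-empty (suc m) f f-zero = begin
    ∑ f (map (outside Vec.∷_) (subsets m) ++ map (inside Vec.∷_) (subsets m))
      ≈⟨ ∑-++ (map (outside Vec.∷_) (subsets m)) _ ⟩
    ∑ f (map (outside Vec.∷_) (subsets m)) + ∑ f (map (inside Vec.∷_) (subsets m))
      ≈⟨ +-cong (∑-map f (outside Vec.∷_) (subsets m)) (∑-map f (inside Vec.∷_) (subsets m)) ⟩
    ∑ (λ B → f (outside Vec.∷ B)) (subsets m) + ∑ (λ B → f (inside Vec.∷ B)) (subsets m)
      ≈⟨ +-cong (∑-subsets-empty m (λ B → f (outside Vec.∷ B)) (λ B ne → f-zero _ (nonempty-out ne)))
           (∑-0 (subsets m) (λ B → f-zero _ (zero , Vec.here))) ⟩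
    f ∅ + 0#  ≈⟨ +-identityʳ _ ⟩
    f ∅       ∎

  familySum : ∀ m → (List (Subset m) → Carrier) → Carrier
  familySum m Φ = ∑ (λ π → when (isSetPartition? π) (Φ π)) (families m)

  familySum-cong : ∀ m {Φ Ψ} → (∀ π → IsSetPartition π → Φ π ≈ Ψ π) → familySum m Φ ≈ familySum m Ψ
  familySum-cong m eq = ∑-cong (families m) λ π → when-cong (isSetPartition? π) (eq π)

  -- A family on suc m points is a sublist of the subsets avoiding the first point followed by a
  -- sublist of those containing it; in a partition the latter has a single member `inn B`. If B is
  -- empty, the other blocks partition the remaining points. Otherwise B ∷ σ does, and summing over
  -- B and σ amounts to choosing a partition and one of its blocks.
  familySum-suc : ∀ m {Φ} → Symmetric Φ → familySum (suc m) Φ ≈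
    familySum m (λ π → Φ (extend ∅ π) + pickSum (λ B σ → Φ (extend B σ)) π)
  familySum-suc m {Φ} Φ-sym = begin
    ∑ part (sublists (map out 𝓢 ++ map inn 𝓢))
      ≈⟨ ∑-sublists-++ part (map out 𝓢) (map inn 𝓢) ⟩
    ∑ (λ σ → ∑ (λ τ → part (σ ++ τ)) (sublists (map inn 𝓢))) (sublists (map out 𝓢))
      ≈⟨ ∑-sublists-map (λ σ → ∑ (λ τ → part (σ ++ τ)) (sublists (map inn 𝓢))) out 𝓢 ⟩
    ∑ (λ σ → ∑ (λ τ → part (map out σ ++ τ)) (sublists (map inn 𝓢))) (sublists 𝓢)
      ≈⟨ ∑-cong (sublists 𝓢) (λ σ → trans (∑-sublists-map (λ τ → part (map out σ ++ τ)) inn 𝓢)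
           (∑-sublists-singletons (λ τ → part (map out σ ++ map inn τ))
             (when-no (isSetPartition? _) (λ p → none-extended {σ = σ} (≡.subst IsSetPartition (++-identityʳ (map out σ)) p)))
             (λ B C τ → when-no (isSetPartition? (map out σ ++ map inn (B ∷ C ∷ τ))) (no-two-extended {σ = σ} {B} {C} {τ})) 𝓢)) ⟩
    ∑ (λ σ → ∑ (λ B → part (map out σ ++ inn B ∷ [])) 𝓢) (sublists 𝓢)
      ≈⟨ ∑-swap (λ σ B → part (map out σ ++ inn B ∷ [])) (sublists 𝓢) 𝓢 ⟩
    ∑ (λ B → ∑ (λ σ → part (map out σ ++ inn B ∷ [])) (sublists 𝓢)) 𝓢
      ≈⟨ ∑-cong 𝓢 (λ B → ∑-cong (sublists 𝓢) (split B)) ⟩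
    ∑ (λ B → ∑ (λ σ → new B σ + old B σ) (sublists 𝓢)) 𝓢
      ≈⟨ trans (∑-cong 𝓢 λ B → ∑-+ (sublists 𝓢)) (∑-+ 𝓢) ⟩
    ∑ (λ B → ∑ (new B) (sublists 𝓢)) 𝓢 + ∑ (λ B → ∑ (old B) (sublists 𝓢)) 𝓢
      ≈⟨ +-cong
           (trans (∑-subsets-empty m (λ B → ∑ (new B) (sublists 𝓢)) (λ B ne → ∑-0 (sublists 𝓢) λ σ → when-no (¬? (nonempty? B)) (λ e → e ne)))
             (∑-cong (sublists 𝓢) λ σ → when-yes (¬? (nonempty? {m} ∅)) (λ (i , i∈) → ∉⊥ i∈)))
           -- B cannot recur in σ, because a nonempty set is not disjoint from itself.
           (∑-sublists-pick old (λ B σ B∈σ → when-no (isSetPartition? (B ∷ σ))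
              λ { (ne ∷ _ , dis ∷ _ , _) → disjoint-irrefl ne (All.lookup dis B∈σ) }) 𝓢) ⟩
    ∑ (λ π → when (isSetPartition? π) (Φ (extend ∅ π))) (sublists 𝓢) + ∑ (pickSum old) (sublists 𝓢)
      ≈⟨ +-congˡ (∑-cong (sublists 𝓢) picked) ⟩
    ∑ (λ π → when (isSetPartition? π) (Φ (extend ∅ π))) (sublists 𝓢) +
    ∑ (λ π → when (isSetPartition? π) (pickSum (λ B σ → Φ (extend B σ)) π)) (sublists 𝓢)
      ≈⟨ ∑-+ (sublists 𝓢) ⟨
    ∑ (λ π → when (isSetPartition? π) (Φ (extend ∅ π)) + when (isSetPartition? π) (pickSum (λ B σ → Φ (extend B σ)) π)) (sublists 𝓢)
      ≈⟨ ∑-cong (sublists 𝓢) (λ π → when-+ (isSetPartition? π)) ⟨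
    familySum m (λ π → Φ (extend ∅ π) + pickSum (λ B σ → Φ (extend B σ)) π) ∎
    where
    𝓢 = subsets m
    out inn : Subset m → Subset (suc m)
    out = outside Vec.∷_
    inn = inside Vec.∷_
    part : List (Subset (suc m)) → Carrier
    part π = when (isSetPartition? π) (Φ π)
    new old : Subset m → List (Subset m) → Carrier
    new B σ = when (¬? (nonempty? B)) (when (isSetPartition? σ) (Φ (extend B σ)))
    old B σ = when (isSetPartition? (B ∷ σ)) (Φ (extend B σ))
    split : ∀ B σ → part (map out σ ++ inn B ∷ []) ≈ new B σ + old B σ
    split B σ = trans
      (when-⇔ (isSetPartition? _) (isSetPartition? (extend B σ)) (isSetPartition-↭ rotate) (isSetPartition-↭ (Perm.↭-sym rotate)) (Φ-sym rotate))
      (cases (nonempty? B))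
      where
      rotate : map out σ ++ inn B ∷ [] ↭ extend B σ
      rotate = ++-comm (map out σ) (inn B ∷ [])
      cases : (ne? : Dec (Nonempty B)) → when (isSetPartition? (extend B σ)) (Φ (extend B σ)) ≈
              when (¬? ne?) (when (isSetPartition? σ) (Φ (extend B σ))) + old B σ
      cases (yes ne) = trans
        (when-⇔ (isSetPartition? (extend B σ)) (isSetPartition? (B ∷ σ))
          (λ p → almost⇒partition-∷ ne (extend⇒almost p)) (λ p → almost⇒extend (partition-∷⇒almost p)) refl)
        (sym (+-identityˡ _))
      cases (no e) = trans
        (when-⇔ (isSetPartition? (extend B σ)) (isSetPartition? σ)
          (λ p → almost⇒partition e (extend⇒almost p)) (λ p → almost⇒extend (partition⇒almost e p)) refl)
        (sym (trans (+-congˡ (when-no (isSetPartition? (B ∷ σ)) λ { (ne ∷ _ , _) → e ne })) (+-identityʳ _)))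
    picked : ∀ π → pickSum old π ≈ when (isSetPartition? π) (pickSum (λ B σ → Φ (extend B σ)) π)
    picked π = cases (isSetPartition? π)
      where
      cases : (p? : Dec (IsSetPartition π)) → pickSum old π ≈ when p? (pickSum (λ B σ → Φ (extend B σ)) π)
      cases (yes p) = pickSum-cong π λ B σ B∷σ↭π → when-yes (isSetPartition? (B ∷ σ)) (isSetPartition-↭ (Perm.↭-sym B∷σ↭π) p)
      cases (no ¬p) = pickSum-0 π λ B σ B∷σ↭π → when-no (isSetPartition? (B ∷ σ)) (λ p → ¬p (isSetPartition-↭ B∷σ↭π p))

-- Block types of subsets, and I as a weighted partition sum

side : Variable → Side
side 𝕩 = inside
side 𝕪 = outside

blockType : ∀ {m} → Subset m → Subset m → Block
blockType S B = ∣ B ∩ S ∣ , ∣ B ∩ ∁ S ∣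

blockType-in : ∀ {m} v (S B : Subset m) → blockType (side v Vec.∷ S) (inside Vec.∷ B) ≡ blockType S B ⊕ v
blockType-in 𝕩 S B = ≡.refl
blockType-in 𝕪 S B = ≡.refl

blockType-∅ : ∀ {m} (S : Subset m) → blockType S ∅ ≡ (0 , 0)
blockType-∅ {m} S = ≡.cong₂ _,_
  (≡.trans (≡.cong ∣_∣ (∩-zeroˡ S)) (∣⊥∣≡0 m)) (≡.trans (≡.cong ∣_∣ (∩-zeroˡ (∁ S))) (∣⊥∣≡0 m))

blockType-⁅⁆ : ∀ {m} (S : Subset m) i → i ∉ S → blockType S ⁅ i ⁆ ≡ (0 , 1)
blockType-⁅⁆ (inside Vec.∷ S)  zero    i∉S = ⊥-elim (i∉S Vec.here)
blockType-⁅⁆ (outside Vec.∷ S) zero    i∉S = ≡.cong (_⊕ 𝕪) (blockType-∅ S)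
blockType-⁅⁆ (_ Vec.∷ S)       (suc i) i∉S = blockType-⁅⁆ S i (λ i∈S → i∉S (Vec.there i∈S))

blockType-empty : ∀ {m} (S B : Subset m) → blockType S B ≡ (0 , 0) → B ≡ ∅
blockType-empty Vec.[]            Vec.[]              eq = ≡.refl
blockType-empty (_ Vec.∷ S)       (outside Vec.∷ B)   eq = ≡.cong (outside Vec.∷_) (blockType-empty S B eq)
blockType-empty (inside Vec.∷ S)  (inside Vec.∷ B)    ()
blockType-empty (outside Vec.∷ S) (inside Vec.∷ B)    ()

blockType-large : ∀ {m} (S B : Subset m) → (0 , 1) ≡ blockType S B → ∃ λ i → i ∉ S × B ≡ ⁅ i ⁆
blockType-large Vec.[]            Vec.[]            ()
blockType-large (s Vec.∷ S)       (outside Vec.∷ B) eq with blockType-large S B eq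
... | i , i∉S , B≡⁅i⁆ = suc i , (λ { (Vec.there i∈S) → i∉S i∈S }) , ≡.cong (outside Vec.∷_) B≡⁅i⁆
blockType-large (inside Vec.∷ S)  (inside Vec.∷ B)  ()
blockType-large (outside Vec.∷ S) (inside Vec.∷ B)  eq = zero , (λ ()) ,
  ≡.cong (inside Vec.∷_) (blockType-empty S B (≡.cong (λ b → proj₁ b , pred (proj₂ b)) (≡.sym eq)))

module FamilyTypes {c ℓ} (A : CommutativeRing c ℓ) where

  open CommutativeRing A hiding (zero)
  open Functionals A
  open ListSums A
  open import Relation.Binary.Reasoning.Setoid setoid

  familySum-types-suc : ∀ {m} v (S : Subset m) {Φ} → Symmetric Φ →
    familySum (suc m) (λ π → Φ (map (blockType (side v Vec.∷ S)) π)) ≈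
    familySum m (λ π → insert v Φ (map (blockType S) π))
  familySum-types-suc {m} v S {Φ} Φ-sym = trans
    (familySum-suc m (λ p → Φ-sym (↭-map⁺ _ p)))
    (familySum-cong m λ π _ → +-cong
      (reflexive (≡.cong Φ (≡.cong₂ _∷_ (≡.trans (blockType-in v S ∅) (≡.cong (_⊕ v) (blockType-∅ S))) (map-out π))))
      (trans (pickSum-cong π λ B σ _ → reflexive (≡.cong Φ (≡.cong₂ _∷_ (blockType-in v S B) (map-out σ))))
             (sym (pickSum-map (λ b σ → Φ (b ⊕ v ∷ σ)) (blockType S) π))))
    where
    map-out : ∀ σ → map (blockType (side v Vec.∷ S)) (map (outside Vec.∷_) σ) ≡ map (blockType S) σ
    map-out σ = ≡.sym (map-∘ σ)

  -- `small` places the small elements first, and `partitionSum` removes them first, so both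
  -- recursions proceed in step.
  familySum-types : ∀ n j {Φ} → Symmetric Φ →
    familySum (n ℕ.+ j) (λ π → Φ (map (blockType (small n (suc j))) π)) ≈ partitionSum n j Φ
  familySum-types zero zero {Φ} Φ-sym =
    -- On the empty ground set there are two families, the empty one and the one consisting of the
    -- empty set; only the former is a partition.
    trans (+-congˡ (trans (+-identityʳ _) (when-no (isSetPartition? (Vec.[] ∷ [])) {Φ ((0 , 0) ∷ [])} λ { ((() , _) ∷ _ , _) })))
      (trans (+-identityʳ _) (when-yes (isSetPartition? {0} []) ([] , [] , λ ())))
  familySum-types zero (suc j) Φ-sym =
    trans (familySum-types-suc 𝕪 (small 0 (suc j)) Φ-sym) (familySum-types zero j (insert-symmetric 𝕪 Φ-sym))
  familySum-types (suc n) j Φ-sym =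
    trans (familySum-types-suc 𝕩 (small n (suc j)) Φ-sym) (familySum-types n j (insert-symmetric 𝕩 Φ-sym))

  -- Forbidding large singletons amounts to giving them weight 0.
  truncate : (ℕ → ℕ → Carrier) → Block → Carrier
  truncate f (0 , 1) = 0#
  truncate f (s , l) = f s l

  truncate-≢ : ∀ f b → (0 , 1) ≢ b → truncate f b ≈ f (proj₁ b) (proj₂ b)
  truncate-≢ f (0 , 0)           _  = refl
  truncate-≢ f (0 , 1)           b≢ = ⊥-elim (b≢ ≡.refl)
  truncate-≢ f (0 , suc (suc _)) _  = refl
  truncate-≢ f (suc _ , _)       _  = refl

  module _ (f : ℕ → ℕ → Carrier) where

    blockProduct : ∀ {m} → Subset m → List (Subset m) → Carrier
    blockProduct S π = foldr _*_ 1# (map (λ B → f (proj₁ (blockType S B)) (proj₂ (blockType S B))) π)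

    blockProduct≈weight : ∀ {m} (S : Subset m) π → All (λ B → (0 , 1) ≢ blockType S B) π →
      blockProduct S π ≈ weight (truncate f) (length π) (map (blockType S) π)
    blockProduct≈weight S []      []       = refl
    blockProduct≈weight S (B ∷ π) (p ∷ ps) = *-cong (sym (truncate-≢ f (blockType S B) p)) (blockProduct≈weight S π ps)

    -- Of the three conditions defining Σ only the first stays a condition. A wrong number of blocks
    -- is annihilated by `weight`, and a large singleton by `truncate`.
    inΣ-term : ∀ n k π →
      when (inΣ? n k π) (blockProduct (small n k) π) ≈
      when (isSetPartition? π) (weight (truncate f) k (map (blockType (small n k)) π))
    inΣ-term n k π = cases (length π ℕ.≟ k) (Any.any? (λ B → ≡-dec₂ (0 , 1) (blockType S B)) π)
      where
      S = small n k
      ≡-dec₂ = ×-≡-dec ℕ._≟_ ℕ._≟_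
      cases : Dec (length π ≡ k) → Dec (Any (λ B → (0 , 1) ≡ blockType S B) π) →
        when (inΣ? n k π) (blockProduct S π) ≈ when (isSetPartition? π) (weight (truncate f) k (map (blockType S) π))
      cases (no len) _ = trans (when-no (inΣ? n k π) (λ (_ , eq , _) → len eq))
        (sym (when-0 (isSetPartition? π) (weight-length (truncate f) k _ (λ eq → len (≡.trans (≡.sym (length-map _ π)) eq)))))
      cases (yes len) (yes large) = trans
        (when-no (inΣ? n k π) λ (_ , _ , noLarge) → All.All¬⇒¬Any (All.tabulate (λ B∈π eq →
           let (i , i∉S , B≡) = blockType-large S _ eq in All.lookup (noLarge i i∉S) B∈π B≡)) large)
        (sym (when-0 (isSetPartition? π) (weight-zero (truncate f) k _
           (Any.map⁺ (Any.map (λ eq → reflexive (≡.cong (truncate f) (≡.sym eq))) large)))))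
      cases (yes len) (no ¬large) = when-⇔ (inΣ? n k π) (isSetPartition? π) proj₁
        (λ p → p , len , λ i i∉S → All.map (λ {B} type≢ B≡ → type≢ (≡.sym (≡.trans (≡.cong (blockType S) B≡) (blockType-⁅⁆ S i i∉S)))) all≢)
        (≡.subst (λ l → blockProduct S π ≈ weight (truncate f) l (map (blockType S) π)) len (blockProduct≈weight S π all≢))
        where
        all≢ : All (λ B → (0 , 1) ≢ blockType S B) π
        all≢ = All.¬Any⇒All¬ π ¬large

    ∑-Σ[,] : ∀ n j → ∑ (blockProduct (small n (suc j))) Σ[ n , suc j ] ≈ partitionSum n j (weight (truncate f) (suc j))
    ∑-Σ[,] n j = begin
      ∑ (blockProduct (small n (suc j))) Σ[ n , suc j ]
        ≈⟨ ∑-filter (inΣ? n (suc j)) _ (families (n ℕ.+ j)) ⟩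
      ∑ (λ π → when (inΣ? n (suc j) π) (blockProduct (small n (suc j)) π)) (families (n ℕ.+ j))
        ≈⟨ ∑-cong (families (n ℕ.+ j)) (inΣ-term n (suc j)) ⟩
      familySum (n ℕ.+ j) (λ π → weight (truncate f) (suc j) (map (blockType (small n (suc j))) π))
        ≈⟨ familySum-types n j (weight-symmetric (truncate f) (suc j)) ⟩
      partitionSum n j (weight (truncate f) (suc j)) ∎

-- Differentiating the formula

module SumTo {c ℓ} (A : CommutativeRing c ℓ) where

  open CommutativeRing A hiding (zero)
  open IntegerSolver A
  open ListSums A using (∑; ∑-map)
  open import Relation.Binary.Reasoning.Setoid setoid

  sumTo : (ℕ → Carrier) → ℕ → Carrier
  sumTo f n = foldr _+_ 0# (applyUpTo f n)

  ∑-map-suc-upTo : ∀ f n → ∑ f (map suc (upTo n)) ≈ sumTo (λ j → f (suc j)) n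
  ∑-map-suc-upTo f n = trans (∑-map f suc (upTo n)) (reflexive (≡.cong (foldr _+_ 0#) (map-upTo (λ j → f (suc j)) n)))

  sumTo-cong : ∀ {f g} → (∀ j → f j ≈ g j) → ∀ n → sumTo f n ≈ sumTo g n
  sumTo-cong eq zero    = refl
  sumTo-cong eq (suc n) = +-cong (eq 0) (sumTo-cong (λ j → eq (suc j)) n)

  sumTo-+ : ∀ f g n → sumTo (λ j → f j + g j) n ≈ sumTo f n + sumTo g n
  sumTo-+ f g zero    = sym (+-identityˡ 0#)
  sumTo-+ f g (suc n) = trans (+-congˡ (sumTo-+ (λ j → f (suc j)) (λ j → g (suc j)) n))
    (solve 4 (λ a b c d → (a :+ b) :+ (c :+ d) := (a :+ c) :+ (b :+ d)) refl _ _ _ _)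

  sumTo-last : ∀ f n → sumTo f (suc n) ≈ sumTo f n + f n
  sumTo-last f zero    = +-comm _ _
  sumTo-last f (suc n) = trans (+-congˡ (sumTo-last (λ j → f (suc j)) n)) (sym (+-assoc _ _ _))

  -- Differentiating the j-th term contributes at the indices j, j + 1 and j + 2. Regrouping by
  -- index lengthens the sum by two, as 2 m - 1 becomes 2 (m + 1) - 1, and the hypotheses are the
  -- boundary terms this creates.
  sumTo-shift : ∀ {a b c : ℕ → Carrier} K → b 0 ≈ 0# → c 0 ≈ 0# → c 1 ≈ 0# →
    a K ≈ 0# → a (suc K) ≈ 0# → b (suc K) ≈ 0# →
    sumTo (λ j → (a j + b (suc j)) + c (suc (suc j))) K ≈ sumTo (λ j → (a j + b j) + c j) (2 ℕ.+ K)
  sumTo-shift {a} {b} {c} K b₀ c₀ c₁ aₖ aₖ₊₁ bₖ₊₁ = begin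
    sumTo (λ j → (a j + b (suc j)) + c (suc (suc j))) K
      ≈⟨ trans (sumTo-+ (λ j → a j + b (suc j)) (λ j → c (suc (suc j))) K) (+-congʳ (sumTo-+ a (λ j → b (suc j)) K)) ⟩
    (sumTo a K + sumTo (λ j → b (suc j)) K) + sumTo (λ j → c (suc (suc j))) K
      ≈⟨ +-cong (+-cong a-sum b-sum) c-sum ⟨
    (sumTo a (2 ℕ.+ K) + sumTo b (2 ℕ.+ K)) + sumTo c (2 ℕ.+ K)
      ≈⟨ trans (sumTo-+ (λ j → a j + b j) c (2 ℕ.+ K)) (+-congʳ (sumTo-+ a b (2 ℕ.+ K))) ⟨
    sumTo (λ j → (a j + b j) + c j) (2 ℕ.+ K) ∎
    where
    drop-last : ∀ f n → f n ≈ 0# → sumTo f (suc n) ≈ sumTo f n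
    drop-last f n fn≈0 = trans (sumTo-last f n) (trans (+-congˡ fn≈0) (+-identityʳ _))
    drop-first : ∀ {x y} → x ≈ 0# → x + y ≈ y
    drop-first x≈0 = trans (+-congʳ x≈0) (+-identityˡ _)
    a-sum = trans (drop-last a (suc K) aₖ₊₁) (drop-last a K aₖ)
    b-sum = trans (drop-last b (suc K) bₖ₊₁) (drop-first b₀)
    c-sum = trans (drop-first c₀) (drop-first c₁)

module DerivativesOfSums (R : CompleteOrderedField) (S : Pred (Calculus.ℝ R) 0ℓ) (a : Calculus.ℝ R) where

  open CompleteOrderedField R hiding (zero)
  open Calculus R
  open Limits R S a
  open Functionals commutativeRing
  open SumTo commutativeRing
  open IntegerSolver commutativeRing
  open Exp semiring using (_^_)
  open import Algebra.Properties.Semiring.Mult semiring using () renaming (_×_ to _·_)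

  deriv-sumTo : ∀ {f : ℝ → ℕ → ℝ} {f′ : ℕ → ℝ} → (∀ j → Deriv (λ t → f t j) (f′ j)) →
                ∀ n → Deriv (λ t → sumTo (f t) n) (sumTo f′ n)
  deriv-sumTo p zero    = deriv-const 0#
  deriv-sumTo p (suc n) = deriv-+ (p 0) (deriv-sumTo (λ j → p (suc j)) n)

  deriv-pickSum : ∀ {X : Set} {H : ℝ → X → List X → ℝ} {H′ : X → List X → ℝ} τ →
    (∀ b σ → b ∷ σ ↭ τ → Deriv (λ t → H t b σ) (H′ b σ)) →
    Deriv (λ t → pickSum (H t) τ) (pickSum H′ τ)
  deriv-pickSum []      p = deriv-const 0#
  deriv-pickSum (b ∷ τ) p = deriv-+ (p b τ Perm.refl)
    (deriv-pickSum τ λ b′ σ b′∷σ↭τ → p b′ (b ∷ σ) (Perm.trans (Perm.swap b′ b Perm.refl) (Perm.prep b b′∷σ↭τ)))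

  deriv-insert : ∀ v {d} {Φ : ℝ → Monomial → ℝ} {Φ′ : Monomial → ℝ} →
    (∀ τ → Partitions (d ⊕ v) τ → Deriv (λ t → Φ t τ) (Φ′ τ)) →
    ∀ τ → Partitions d τ → Deriv (λ t → insert v (Φ t) τ) (insert v Φ′ τ)
  deriv-insert v p τ q = deriv-+ (p _ (partitions-unit v q))
    (deriv-pickSum τ λ b σ b∷σ↭τ → p _ (partitions-⊕ v (partitions-↭ (Perm.↭-sym b∷σ↭τ) q)))

  deriv-partitionSum : ∀ m j {Φ : ℝ → Monomial → ℝ} {Φ′ : Monomial → ℝ} →
    (∀ τ → Partitions (m , j) τ → Deriv (λ t → Φ t τ) (Φ′ τ)) →
    Deriv (λ t → partitionSum m j (Φ t)) (partitionSum m j Φ′)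
  deriv-partitionSum zero    zero    p = p [] ([] , ≡.refl)
  deriv-partitionSum zero    (suc j) p = deriv-partitionSum zero j (deriv-insert 𝕪 p)
  deriv-partitionSum (suc m) j       p = deriv-partitionSum m j (deriv-insert 𝕩 p)

  deriv-weight : ∀ {g : ℝ → Block → ℝ} {h} k τ → All (λ b → Deriv (λ t → g t b) (h b)) τ →
    Deriv (λ t → weight (g t) (suc k) τ) (derivation h (g a) k τ)
  deriv-weight k []      [] = deriv-const 0#
  deriv-weight {g} {h} zero (b ∷ τ) (p ∷ _) = deriv-congʳ
    (+-cong refl (trans (zeroʳ (g a b)) (sym (pickSum-0 τ λ b′ σ _ → zeroʳ (h b′)))))
    (deriv-* p (weight-zero-const τ))
    where
    weight-zero-const : ∀ τ → Deriv (λ t → weight (g t) zero τ) 0#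
    weight-zero-const []      = deriv-const 1#
    weight-zero-const (_ ∷ _) = deriv-const 0#
  deriv-weight {g} {h} (suc k) (b ∷ τ) (p ∷ ps) = deriv-congʳ
    (+-congˡ (trans (sym (pickSum-*ˡ (g a b) τ))
      (pickSum-cong τ λ b′ σ _ → solve 3 (λ x y z → x :* (y :* z) := y :* (x :* z)) refl (g a b) (h b′) (weight (g a) k σ))))
    (deriv-* p (deriv-weight k τ ps))

  -- With the derivative of u in the form u² v, the result has the power u ^ suc k, and no exponent
  -- k - 1 appears.
  deriv-^ : ∀ {u : ℝ → ℝ} {v} → Deriv u ((u a * u a) * v) →
            ∀ k → Deriv (λ t → u t ^ k) ((k · 1#) * (u a ^ suc k * v))
  deriv-^ p zero    = deriv-congʳ (sym (zeroˡ _)) (deriv-const 1#)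
  deriv-^ {u} {v} p (suc k) = deriv-congʳ
    (solve 4 (λ u v w k → ((u :* u) :* v) :* w :+ u :* (k :* ((u :* w) :* v)) := (con (+ 1) :+ k) :* ((u :* (u :* w)) :* v)) refl
      (u a) v (u a ^ k) (k · 1#))
    (deriv-* p (deriv-^ p k))

-- The implicit function and derivatives along its graph

module ImplicitFunction (em : ExcludedMiddle 0ℓ) (R : CompleteOrderedField) where

  open CompleteOrderedField R hiding (zero)
  open Calculus R
  open OrderedField R
  open MeanValue em R
  open IntegerSolver commutativeRing
  open Functionals commutativeRing
  open FamilyTypes commutativeRing
  open SumTo commutativeRing
  open Exp semiring using (_^_)
  open import Algebra.Properties.Semiring.Mult semiring using () renaming (_×_ to _·_)

  module Curve
    {N : ℕ} (1≤N : 1 ℕ.≤ N) {U : Pred ℝ² 0ℓ} (U-open : Open² U) {F : ℝ² → ℝ} (C : ContDiff N U F)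
    {J : Pred ℝ 0ℓ} (J-open : Open J) {y : ℝ → ℝ} (y-diff : DifferentiableOn J y)
    (graph : ∀ {x} → J x → U (x , y x))
    (solution : ∀ {x} → J x → F (x , y x) ≈ 0#)
    (Fy≉0 : ∀ {x} → J x → ContDiff.Fy C (x , y x) ≉ 0#)
    where

    open ContDiff C
    open DerivativesOfSums R J

    private
      module LimJ a = Limits R J a

    open LimJ using (Deriv)

    g : ℝ → Block → ℝ
    g x = truncate (λ s l → mixed s l (x , y x))

    module Rec (x : ℝ) = Recurrence (g x) refl
    open Rec

    u slope : ℝ → ℝ
    u x = - (Fy (x , y x) ⁻¹)
    slope x = u x * g x (1 , 0)

    module AtPoint {a : ℝ} (Ja : J a) where

      open LimJ a hiding (Deriv)

      p : ℝ²
      p = a , y a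

      accumulates : ∀ δ → 0# < δ → ∃ λ b → J b × b ≉ a × abs (b - a) < δ
      accumulates = open-accumulates (J-open Ja)

      chain : ∀ w → length w ℕ.< N → ∀ {d} → Deriv a y d →
              Deriv a (λ t → ∂ w (t , y t)) (∂ (𝕩 ∷ w) p + ∂ (𝕪 ∷ w) p * d)
      chain w len = ChainRule.chain-rule U-open (∂-continuous w (ℕ.<⇒≤ len)) (∂-continuous (𝕩 ∷ w) len)
        (∂-∷ 𝕩 w len) graph Ja (∂-∷ 𝕪 w len (graph Ja))

      -- Along the curve F is constantly 0, so by the chain rule and uniqueness of derivatives Fx +
      -- Fy d is 0; solving for d gives u Fx.
      deriv-y : Deriv a y (slope a)
      deriv-y with y-diff Ja
      ... | d , has-d = deriv-congʳ d≈slope y-deriv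
        where
        y-deriv : Deriv a y d
        y-deriv = hasDerivative⇒deriv has-d
        total : ∂ (𝕩 ∷ []) p + ∂ (𝕪 ∷ []) p * d ≈ 0#
        total = deriv-unique accumulates
          (deriv-cong (λ Jt → trans (∂-[] (graph Jt)) (solution Jt)) (trans (∂-[] (graph Ja)) (solution Ja)) refl
            (chain [] 1≤N y-deriv))
          (deriv-const 0#)
        fx = ∂ (𝕩 ∷ []) p
        fy = ∂ (𝕪 ∷ []) p
        d≈slope : d ≈ slope a
        d≈slope = begin
          d                                         ≈⟨ *-identityʳ d ⟨
          d * 1#                                    ≈⟨ *-congˡ (⁻¹-inverseʳ (Fy≉0 Ja)) ⟨
          d * (fy * fy ⁻¹)                          ≈⟨ solve 4 (λ d x y i → d :* (y :* i) := (x :+ y :* d) :* i :+ (:- i) :* x) refl d fx fy (fy ⁻¹) ⟩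
          (fx + fy * d) * fy ⁻¹ + - (fy ⁻¹) * fx    ≈⟨ trans (+-congʳ (trans (*-congʳ total) (zeroˡ _))) (+-identityˡ _) ⟩
          - (fy ⁻¹) * fx                            ∎
          where open import Relation.Binary.Reasoning.Setoid setoid

      deriv-mixed : ∀ s l → s ℕ.+ l ℕ.< N →
        Deriv a (λ t → mixed s l (t , y t)) (mixed (suc s) l p + mixed s (suc l) p * slope a)
      deriv-mixed s l s+l<N = deriv-congʳ (+-congˡ (*-congʳ (∂𝕪-mixed U-open C s l s+l<N (graph Ja))))
        (chain (replicate s 𝕩 ++ replicate l 𝕪) (≡.subst (ℕ._< N) (≡.sym (length-word s l)) s+l<N) deriv-y)

      g′ : Block → ℝ
      g′ b = shift a 𝕩 b + slope a * shift a 𝕪 b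

      -- At a large singleton the weight is constantly 0 along the curve, in agreement with `shift`
      -- being 0 there; elsewhere it is a genuine partial derivative of F.
      deriv-g : ∀ b → 1 ℕ.≤ size b → size b ℕ.< N → Deriv a (λ t → g t b) (g′ b)
      deriv-g (0 , 1)           _ _      = deriv-congʳ (sym (trans (+-identityˡ _) (zeroʳ (slope a)))) (deriv-const 0#)
      deriv-g (0 , suc (suc l)) _ size<N = deriv-congʳ (+-congˡ (*-comm _ _)) (deriv-mixed 0 (suc (suc l)) size<N)
      deriv-g (suc s , l)       _ size<N = deriv-congʳ (+-congˡ (*-comm _ _)) (deriv-mixed (suc s) l size<N)

      -- Only lists of the right length obey the bound m on block sizes that makes their factors
      -- differentiable. For all others the weight is 0 along the whole curve.
      deriv-weight-g : ∀ {m} → m ℕ.< N → ∀ {j} τ → Partitions (m , j) τ →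
        Deriv a (λ t → weight (g t) (suc j) τ) (derivation g′ (g a) j τ)
      deriv-weight-g m<N {j} τ q with length τ ℕ.≟ suc j
      ... | yes len = deriv-weight a j τ (All.zipWith
        (λ { {b} (1≤size , size≤m) → deriv-g b 1≤size (ℕ.≤-<-trans size≤m m<N) })
        (Partitions.nonempty q , block-size≤ q len))
      ... | no len  = deriv-cong (λ {t} _ → sym (weight-length (g t) (suc j) τ len)) (sym (weight-length (g a) (suc j) τ len))
        (sym (derivation-length g′ (g a) j τ len)) (deriv-const 0#)

      deriv-P : ∀ {m} → m ℕ.< N → ∀ j → Deriv a (λ t → P t m j) (∂P a 𝕩 m j + slope a * ∂P a 𝕪 m j)
      deriv-P {m} m<N j = deriv-congʳ linear (deriv-partitionSum a m j (deriv-weight-g m<N))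
        where
        open import Relation.Binary.Reasoning.Setoid setoid
        linear : partitionSum m j (derivation g′ (g a) j) ≈ ∂P a 𝕩 m j + slope a * ∂P a 𝕪 m j
        linear = begin
          partitionSum m j (derivation g′ (g a) j)
            ≈⟨ partitionSum-cong m j (λ τ _ → trans
                 (pickSum-cong τ λ b σ _ → trans (distribʳ _ _ _) (+-congˡ (*-assoc _ _ _)))
                 (trans (pickSum-+ τ) (+-congˡ (pickSum-*ˡ (slope a) τ)))) ⟩
          partitionSum m j (λ τ → derivation (shift a 𝕩) (g a) j τ + slope a * derivation (shift a 𝕪) (g a) j τ)
            ≈⟨ trans (partitionSum-+ m j) (+-congˡ (partitionSum-*ˡ m j (slope a))) ⟩
          ∂P a 𝕩 m j + slope a * ∂P a 𝕪 m j ∎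

      v : ℝ
      v = g a (1 , 1) + slope a * g a (0 , 2)

      deriv-u : 1 ℕ.< N → Deriv a u ((u a * u a) * v)
      deriv-u 1<N = deriv-cong (λ _ → neg _) (neg _)
        (solve 4 (λ x y s i → :- con (+ 1) :* :- ((x :+ y :* s) :* (i :* i)) := (:- i :* :- i) :* (x :+ s :* y)) refl
          (g a (1 , 1)) (g a (0 , 2)) (slope a) (Fy p ⁻¹))
        (deriv-*ˡ (- 1#) (deriv-⁻¹ Fy≉0 (Fy≉0 Ja) (deriv-mixed 0 1 1<N)))
        where
        neg : ∀ x → - 1# * x ≈ - x
        neg = solve 1 (λ x → :- con (+ 1) :* x := :- x) refl

    module Step (x : ℝ) (m : ℕ) where

      gx = g x (1 , 0)
      gxy = g x (1 , 1)
      gyy = g x (0 , 2)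

      -- The contributions to d/dx of the j-th term of the formula of order m,
      -- indexed by the power of u they carry.
      a b c : ℕ → ℝ
      a j             = u x ^ suc j * ∂P x 𝕩 m j
      b zero          = 0#
      b (suc i)       = u x ^ suc (suc i) * (gx * ∂P x 𝕪 m i + gxy * ((suc i · 1#) * P x m i))
      c zero          = 0#
      c (suc zero)    = 0#
      c (suc (suc i)) = u x ^ suc (suc (suc i)) * (gx * (gyy * ((suc i · 1#) * P x m i)))

      term-derivative : ∀ j →
        ((suc j · 1#) * (u x ^ suc (suc j) * (gxy + slope x * gyy))) * P x m j +
        u x ^ suc j * (∂P x 𝕩 m j + slope x * ∂P x 𝕪 m j)
        ≈ (a j + b (suc j)) + c (suc (suc j))
      term-derivative j = solve 9 (λ k u w gx gxy gyy p px py →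
          (k :* ((u :* w) :* (gxy :+ (u :* gx) :* gyy))) :* p :+ w :* (px :+ (u :* gx) :* py)
          := (w :* px :+ (u :* w) :* (gx :* py :+ gxy :* (k :* p))) :+ (u :* (u :* w)) :* (gx :* (gyy :* (k :* p)))) refl
        (suc j · 1#) (u x) (u x ^ suc j) gx gxy gyy (P x m j) (∂P x 𝕩 m j) (∂P x 𝕪 m j)

      -- The cases 0, 1 and at least 2 count the large elements available: the term b uses up one of
      -- them and c uses up two.
      term-split : 1 ℕ.≤ m → ∀ j → u x ^ suc j * P x (suc m) j ≈ (a j + b j) + c j
      term-split 1≤m j = trans (*-congˡ (partitionSum-insert-weight x 𝕩 m j)) (cases 1≤m j)
        where
        cases : 1 ℕ.≤ m → ∀ j → u x ^ suc j * (gx * partitionSum m j (weight (g x) j) + (∂P x 𝕩 m j + gxy * markedP x m j)) ≈ (a j + b j) + c j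
        -- A new small singleton would leave at least one small element to be partitioned into 0
        -- blocks.
        cases (ℕ.s≤s {n = m′} _) zero = trans
          (*-congˡ (+-cong (*-congˡ (partitionSum-weight-zero x m′)) (+-congˡ (*-congˡ (markedP-zero x m)))))
          (solve 4 (λ w gx px gxy → w :* (gx :* con (+ 0) :+ (px :+ gxy :* con (+ 0))) := (w :* px :+ con (+ 0)) :+ con (+ 0)) refl _ _ _ _)
        cases _ (suc zero) = trans
          (*-congˡ (+-cong (*-congˡ (trans (partitionSum-weight-suc x m 0) (+-congˡ (*-congˡ (markedP-zero x m)))))
                           (+-congˡ (*-congˡ (markedP-suc x m 0)))))
          (solve 7 (λ w gx gxy gyy px py kp → w :* (gx :* (py :+ gyy :* con (+ 0)) :+ (px :+ gxy :* kp))
              := (w :* px :+ w :* (gx :* py :+ gxy :* kp)) :+ con (+ 0)) refl _ _ _ _ _ _ _)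
        cases _ (suc (suc r)) = trans
          (*-congˡ (+-cong (*-congˡ (trans (partitionSum-weight-suc x m (suc r)) (+-congˡ (*-congˡ (markedP-suc x m r)))))
                           (+-congˡ (*-congˡ (markedP-suc x m (suc r))))))
          (solve 8 (λ w gx gxy gyy px py kp kq → w :* (gx :* (py :+ gyy :* kq) :+ (px :+ gxy :* kp))
              := (w :* px :+ w :* (gx :* py :+ gxy :* kp)) :+ w :* (gx :* (gyy :* kq))) refl _ _ _ _ _ _ _ _)

    bound : ℕ → ℕ
    bound m = 2 ℕ.* m ℕ.∸ 1

    formula : ℕ → ℝ → ℝ
    formula m x = sumTo (λ j → u x ^ suc j * P x m j) (bound m)

    m+m≤bound : ∀ m → m ℕ.+ m ℕ.≤ suc (bound m)
    m+m≤bound zero    = ℕ.z≤n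
    m+m≤bound (suc m) = ℕ.≤-reflexive (≡.cong (λ k → suc (m ℕ.+ suc k)) (≡.sym (ℕ.+-identityʳ m)))

    bound-suc : ∀ {m} → 1 ℕ.≤ m → bound (suc m) ≡ 2 ℕ.+ bound m
    bound-suc {suc m} _ = ≡.cong suc (ℕ.+-suc m (suc (m ℕ.+ 0)))

    formula-step : ∀ m → 1 ℕ.≤ m → m ℕ.< N → ∀ {x} → J x → Deriv x (formula m) (formula (suc m) x)
    formula-step m 1≤m m<N {x} Jx = deriv-congʳ total
      (deriv-sumTo x (λ j → deriv-* (deriv-^ x (deriv-u (ℕ.≤-<-trans 1≤m m<N)) (suc j)) (deriv-P m<N j)) (bound m))
      where
      open AtPoint Jx
      open LimJ x hiding (Deriv)
      open Step x m
      K = bound m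
      vanish₀ : ∀ {w y} → y ≈ 0# → w * y ≈ 0#
      vanish₀ y≈0 = trans (*-congˡ y≈0) (zeroʳ _)
      total : sumTo (λ j → ((suc j · 1#) * (u x ^ suc (suc j) * v)) * P x m j + u x ^ suc j * (∂P x 𝕩 m j + slope x * ∂P x 𝕪 m j)) K
              ≈ formula (suc m) x
      total = begin
        _ ≈⟨ sumTo-cong term-derivative K ⟩
        sumTo (λ j → (a j + b (suc j)) + c (suc (suc j))) K
          -- The lower boundary terms are 0 by definition of b and c. The upper ones are 0 because
          -- `P` and `∂P` vanish from the index K = 2 m - 1 on.
          ≈⟨ sumTo-shift {a} {b} {c} K refl refl refl
               (vanish₀ (∂P-vanishes x 𝕩 m K (m+m≤bound m)))
               (vanish₀ (∂P-vanishes x 𝕩 m (suc K) (ℕ.m≤n⇒m≤1+n (m+m≤bound m))))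
               (vanish₀ (trans (+-cong (vanish₀ (∂P-vanishes x 𝕪 m K (m+m≤bound m)))
                                       (vanish₀ (vanish₀ (P-vanishes x m K (m+m≤bound m)))))
                               (+-identityˡ 0#))) ⟩
        sumTo (λ j → (a j + b j) + c j) (2 ℕ.+ K)
          ≈⟨ sumTo-cong (term-split 1≤m) (2 ℕ.+ K) ⟨
        sumTo (λ j → u x ^ suc j * P x (suc m) j) (2 ℕ.+ K)
          ≡⟨ ≡.cong (sumTo (λ j → u x ^ suc j * P x (suc m) j)) (bound-suc 1≤m) ⟨
        formula (suc m) x ∎
        where open import Relation.Binary.Reasoning.Setoid setoid

    -- The induction starts at order 1, since the formula of order 0 is an empty sum and not y. The
    -- only partition of one small element has the single block type (1 , 0).
    formula-one : ∀ x → slope x ≈ formula 1 x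
    formula-one x = solve 2 (λ u p → u :* p := (u :* con (+ 1)) :* (p :* con (+ 1) :+ con (+ 0)) :+ con (+ 0)) refl (u x) (g x (1 , 0))

    statement : ℕ → ℝ → ℝ
    statement n x = sum (map (λ k → (- 1#) ^ k * (Fy (x , y x) ⁻¹) ^ k * I C n k (x , y x)) (map suc (upTo (2 ℕ.* n ℕ.∸ 1))))

    formula≈statement : ∀ n x → formula n x ≈ statement n x
    formula≈statement n x = sym (trans (∑-map-suc-upTo (λ k → (- 1#) ^ k * (Fy (x , y x) ⁻¹) ^ k * I C n k (x , y x)) (bound n))
      (sumTo-cong (λ j → *-cong (signed (suc j)) (∑-Σ[,] (λ s l → mixed s l (x , y x)) n j)) (bound n)))
      where
      signed : ∀ k → (- 1#) ^ k * (Fy (x , y x) ⁻¹) ^ k ≈ u x ^ k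
      signed zero    = *-identityˡ 1#
      signed (suc k) = trans
        (solve 3 (λ s i q → (:- con (+ 1) :* s) :* (i :* q) := :- i :* (s :* q)) refl ((- 1#) ^ k) (Fy (x , y x) ⁻¹) ((Fy (x , y x) ⁻¹) ^ k))
        (*-congˡ (signed k))

    nth-derivative : ∀ m → suc m ℕ.≤ N → IsNthDerivative J (suc m) y (statement (suc m))
    nth-derivative zero _ = y , (λ _ → refl) , λ {x} Jx → LimJ.deriv⇒hasDerivative x
      (LimJ.deriv-congʳ x (trans (formula-one x) (formula≈statement 1 x)) (AtPoint.deriv-y Jx))
    nth-derivative (suc m) m<N = statement (suc m) , nth-derivative m (ℕ.<⇒≤ m<N) , λ {x} Jx → LimJ.deriv⇒hasDerivative x
      (LimJ.deriv-cong x (λ {t} _ → formula≈statement (suc m) t) (formula≈statement (suc m) x) (formula≈statement (suc (suc m)) x)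
        (formula-step (suc m) (ℕ.s≤s ℕ.z≤n) m<N Jx))

theorem2 :
    ExcludedMiddle 0ℓ →
    (R : CompleteOrderedField) →
    let open CompleteOrderedField R
        open Exp semiring using (_^_)
        open Calculus R
    in
    (n : ℕ) → 1 ℕ.≤ n →
    (U : Pred ℝ² 0ℓ) → Open² U →
    (F : ℝ² → ℝ) (C : ContDiff n U F) →
    let open ContDiff C using (Fy) in
    (J : Pred ℝ 0ℓ) → IsOpenInterval J →
    (y : ℝ → ℝ) → RespectsEqualityOn J y → DifferentiableOn J y →
    (∀ {x} → J x → U (x , y x)) →
    (∀ {x} → J x → F (x , y x) ≈ 0#) →
    (∀ {x} → J x → Fy (x , y x) ≉ 0#) →
    IsNthDerivative J n y
      (λ x → sum (map (λ k → (- 1#) ^ k * (Fy (x , y x) ⁻¹) ^ k * I C n k (x , y x))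
                      (map suc (upTo (2 ℕ.* n ℕ.∸ 1)))))
theorem2 em R (suc m) 1≤n U U-open F C J (J-open , _) y _ y-diff graph solution Fy≉0 =
  ImplicitFunction.Curve.nth-derivative em R 1≤n U-open C J-open y-diff graph solution Fy≉0 m ℕ.≤-refl
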